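{- Let $m,n\ge 1$ be integers, $q>0$, $a>0$, $b,c,d\ge 0$. Consider the directed grid $G_{m,n}$ with source $s=(0,0)$, sink $t=(m,n)$, total demand $q$, and latency $\ell(x)=ax+b$ on every grid edge, and add a chord $u\to v$ with latency $\ell_*(x)=cx+d$. Let $z^*$ be the flow on the chord in the User Equilibrium of the augmented network. If $z^*\in(0,q]$, then the difference in total travel times satisfies \[ C_{\mathrm{new}}-C_{\mathrm{old}}\ \le\ -V_{uv}\,z^*. \] Consequently, $V_{uv}<0$ is necessary for Braess' Paradox: if $C_{\mathrm{new}}>C_{\mathrm{old}}$, then $V_{uv}<0$.
   Context: Grid: $G_{m,n}=(V,E)$ is the directed graph with vertex set $V=\{0,\dots,m\}\times\{0,\dots,n\}$ and directed edges $(i,j)\to(i+1,j)$ for $i<m$ and $(i,j)\to(i,j+1)$ for $j<n$. Chord: an added directed edge $u\to v$ with $u,v\in V$, $u\ne v$, such that $uv$ is not an edge of the underlying undirected grid. Feasible flow (in the grid, or in the grid plus chord): a nonnegative number $f_e$ for each directed edge $e$, with flow conserved at every vertex other than $s,t$, and net outflow from $s$ and net inflow to $t$ both equal to $q$. Its cost (total travel time) is $C(f)=\sum_e f_e\ell_e(f_e)$. User Equilibrium: a feasible flow, decomposable into flows along $s$-$t$ paths, such that every path carrying positive flow has latency (sum of $\ell_e(f_e)$ over its edges) no larger than that of any other $s$-$t$ path. By a classical theorem (Beckmann, McGuire, Winsten) these are exactly the minimizers over feasible flows of the Beckmann potential $Z(f)=\sum_e\int_0^{f_e}\ell_e(y)\,dy$;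 in the networks considered here the minimizer is unique. $C_{\mathrm{old}}$ is the cost of the User Equilibrium of $G_{m,n}$; $C_{\mathrm{new}}$ is the cost of the User Equilibrium of $G_{m,n}$ with the chord added (same $s,t,q$). Braess' Paradox occurs when $C_{\mathrm{new}}/C_{\mathrm{old}}>1$. Electrical quantities: $\mathsf L$ is the weighted graph Laplacian of the underlying undirected grid in which every edge has resistance $a$ (so diagonal entries are $\deg/a$ and off-diagonal entries are $-1/a$ for adjacent vertices and $0$ otherwise), $\mathsf L^+$ is its Moore--Penrose pseudoinverse, $\mathbf e_w\in\mathbb R^{V}$ is the standard basis vector at $w$, and $V_{uv}=q(\mathbf e_s-\mathbf e_t)^{\mathsf T}\mathsf L^+(\mathbf e_u-\mathbf e_v)$. -}

module Defs where

open import Algebra.Apartness.Bundles using (HeytingField)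
open import Algebra.Bundles using (CommutativeRing)
open import Algebra.Definitions.RawMonoid using () renaming (_×_ to multiple)
open import Data.Bool.Base using (if_then_else_)
open import Data.Fin.Base using (Fin; zero; suc; inject₁; fromℕ)
import Data.Fin.Properties as Fin
open import Data.List.Base using (List; []; _∷_; _++_; map; foldr; filter; length; allFin; cartesianProduct)
open import Data.List.Membership.Propositional using (_∈_; find; lose)
open import Data.List.Membership.Propositional.Properties
  using (∈-map⁺; ∈-map⁻; ∈-++⁺ˡ; ∈-++⁺ʳ; ∈-allFin; ∈-cartesianProduct⁺)
open import Data.List.Relation.Unary.All using (All; universal)
import Data.List.Relation.Unary.All.Properties as All
open import Data.List.Relation.Unary.AllPairs using (_∷_)
open import Data.List.Relation.Unary.Any using (here; there; any?)
open import Data.List.Relation.Unary.Unique.Propositional using (Unique)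
import Data.List.Relation.Unary.Unique.Propositional.Properties as Unique
open import Data.Maybe.Base using (Maybe; just; nothing; maybe)
import Data.Maybe.Properties as Maybe
open import Data.Nat.Base using (ℕ; suc)
open import Data.Product.Base using (∃; _×_; _,_; proj₁; proj₂; uncurry)
import Data.Product.Properties as Product
open import Data.Sum.Base using (_⊎_)
open import Level using (Level; _⊔_) renaming (suc to lsuc)
open import Relation.Binary.Core using (Rel)
open import Relation.Binary.Definitions using (DecidableEquality)
open import Relation.Binary.PropositionalEquality using (_≡_; _≢_; refl; cong)
open import Relation.Binary.Structures using (IsStrictPartialOrder)
open import Relation.Nullary using (¬_; Dec; yes; no; does)
open import Relation.Nullary.Decidable using (map′; _×-dec_; _⊎-dec_)

-- The scalars. The standard library has no real numbers and no ordered
-- fields, so everything below is stated over an arbitrary ordered field.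
-- It is presented through its strict order, with apartness (classically: ≉)
-- meaning comparability, so that no order is assumed to be decidable:
-- ℚ, the classical reals and the constructive reals are all instances.
record OrderedField c ℓ₁ ℓ₂ ℓ₃ : Set (lsuc (c ⊔ ℓ₁ ⊔ ℓ₂ ⊔ ℓ₃)) where
  infix 4 _<_ _≤_
  field
    heytingField : HeytingField c ℓ₁ ℓ₂

  open HeytingField heytingField public

  field
    _<_                    : Rel Carrier ℓ₃
    <-isStrictPartialOrder : IsStrictPartialOrder _≈_ _<_
    #⇒<⊎>                  : ∀ {x y} → x # y → x < y ⊎ y < x
    <⇒#                    : ∀ {x y} → x < y → x # y
    +-monoˡ-<              : ∀ z {x y} → x < y → x + z < y + z
    *-pos                  : ∀ {x y} → 0# < x → 0# < y → 0# < x * y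

  _≤_ : Rel Carrier ℓ₃
  x ≤ y = ¬ (y < x)

  commutativeRing : CommutativeRing c ℓ₁
  commutativeRing = record { isCommutativeRing = isCommutativeRing }

  -- The library inverts differences of apart elements; here x is apart
  -- from 0#, and x - 0# ≈ x.
  recip : ∀ x → 0# < x → Carrier
  recip x 0<x = proj₁ (#⇒invertible (#-sym (<⇒# 0<x)))

record Digraph : Set₁ where
  field
    Vertex : Set
    Edge   : Set
    src    : Edge → Vertex
    tgt    : Edge → Vertex
    _≟ⱽ_   : DecidableEquality Vertex
    _≟ᴱ_   : DecidableEquality Edge

    vertices          : List Vertex
    vertices-complete : ∀ v → v ∈ vertices
    vertices-unique   : Unique vertices

    edges             : List Edge
    edges-complete    : ∀ e → e ∈ edges
    edges-unique      : Unique edges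

  Joins : Edge → Vertex → Vertex → Set
  Joins e u v = (src e ≡ u × tgt e ≡ v) ⊎ (src e ≡ v × tgt e ≡ u)

  -- Adjacency in the underlying undirected graph.
  Adjacent : Vertex → Vertex → Set
  Adjacent u v = ∃ λ e → Joins e u v

  adjacent? : ∀ u v → Dec (Adjacent u v)
  adjacent? u v = map′ from to (any? joins? edges)
    where
    joins? : ∀ e → Dec (Joins e u v)
    joins? e = ((src e ≟ⱽ u) ×-dec (tgt e ≟ⱽ v)) ⊎-dec ((src e ≟ⱽ v) ×-dec (tgt e ≟ⱽ u))
    from = λ p → let (e , _ , j) = find p in e , j
    to   = λ (e , j) → lose (edges-complete e) j

  degree : Vertex → ℕ
  degree u = length (filter (adjacent? u) vertices)

  IsChord : Vertex → Vertex → Set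
  IsChord u v = u ≢ v × ¬ Adjacent u v

  IsWalk : Vertex → List Edge → Vertex → Set
  IsWalk u []       w = u ≡ w
  IsWalk u (e ∷ es) w = src e ≡ u × IsWalk (tgt e) es w

  record Path (u w : Vertex) : Set where
    field
      trail  : List Edge
      isWalk : IsWalk u trail w
      simple : Unique (u ∷ map tgt trail)

-- In the augmented graph, `nothing` is the added edge.
addEdge : (G : Digraph) → Digraph.Vertex G → Digraph.Vertex G → Digraph
addEdge G u v = record
  { Vertex            = Vertex
  ; Edge              = Maybe Edge
  ; src               = maybe src u
  ; tgt               = maybe tgt v
  ; _≟ⱽ_              = _≟ⱽ_
  ; _≟ᴱ_              = Maybe.≡-dec _≟ᴱ_
  ; vertices          = vertices
  ; vertices-complete = vertices-complete
  ; vertices-unique   = vertices-unique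
  ; edges             = nothing ∷ map just edges
  ; edges-complete    = λ { nothing  → here refl
                          ; (just e) → there (∈-map⁺ just (edges-complete e)) }
  ; edges-unique      = All.map⁺ (universal (λ _ ()) edges)
                        ∷ Unique.map⁺ Maybe.just-injective edges-unique
  }
  where open Digraph G

GridVertex : ℕ → ℕ → Set
GridVertex m n = Fin (suc m) × Fin (suc n)

-- east i j : (i , j) → (i + 1 , j)   and   north i j : (i , j) → (i , j + 1)
data GridEdge (m n : ℕ) : Set where
  east  : Fin m → Fin (suc n) → GridEdge m n
  north : Fin (suc m) → Fin n → GridEdge m n

grid : ℕ → ℕ → Digraph
grid m n = record
  { Vertex            = GridVertex m n
  ; Edge              = GridEdge m n
  ; src               = λ { (east i j) → inject₁ i , j ; (north i j) → i , inject₁ j }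
  ; tgt               = λ { (east i j) → suc i , j     ; (north i j) → i , suc j }
  ; _≟ⱽ_              = Product.≡-dec Fin._≟_ Fin._≟_
  ; _≟ᴱ_              = _≟_
  ; vertices          = pairs (suc m) (suc n)
  ; vertices-complete = pairs-complete
  ; vertices-unique   = pairs-unique (suc m) (suc n)
  ; edges             = easts ++ norths
  ; edges-complete    = λ
      { (east i j)  → ∈-++⁺ˡ (∈-map⁺ (uncurry east) (pairs-complete (i , j)))
      ; (north i j) → ∈-++⁺ʳ easts (∈-map⁺ (uncurry north) (pairs-complete (i , j))) }
  ; edges-unique      = Unique.++⁺
      (Unique.map⁺ (λ { {_ , _} {_ , _} refl → refl }) (pairs-unique m (suc n)))
      (Unique.map⁺ (λ { {_ , _} {_ , _} refl → refl }) (pairs-unique (suc m) n))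
      disjoint
  }
  where
  _≟_ : DecidableEquality (GridEdge m n)
  east i j  ≟ east k l  = map′ (λ { (refl , refl) → refl }) (λ { refl → refl , refl })
                            ((i Fin.≟ k) ×-dec (j Fin.≟ l))
  east _ _  ≟ north _ _ = no λ ()
  north _ _ ≟ east _ _  = no λ ()
  north i j ≟ north k l = map′ (λ { (refl , refl) → refl }) (λ { refl → refl , refl })
                            ((i Fin.≟ k) ×-dec (j Fin.≟ l))

  pairs : ∀ k l → List (Fin k × Fin l)
  pairs k l = cartesianProduct (allFin k) (allFin l)

  pairs-complete : ∀ {k l} (p : Fin k × Fin l) → p ∈ pairs k l
  pairs-complete (i , j) = ∈-cartesianProduct⁺ (∈-allFin i) (∈-allFin j)

  pairs-unique : ∀ k l → Unique (pairs k l)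
  pairs-unique k l = Unique.cartesianProduct⁺ (Unique.allFin⁺ k) (Unique.allFin⁺ l)

  easts norths : List (GridEdge m n)
  easts  = map (uncurry east)  (pairs m (suc n))
  norths = map (uncurry north) (pairs (suc m) n)

  disjoint : ∀ {e} → ¬ (e ∈ easts × e ∈ norths)
  disjoint (e∈easts , e∈norths)
    with ∈-map⁻ (uncurry east) e∈easts | ∈-map⁻ (uncurry north) e∈norths
  ... | _ , _ , refl | _ , _ , ()

gridSource gridSink : ∀ m n → GridVertex m n
gridSource m n = zero , zero
gridSink   m n = fromℕ m , fromℕ n

module Scalars {c ℓ₁ ℓ₂ ℓ₃} (K : OrderedField c ℓ₁ ℓ₂ ℓ₃) where
  open OrderedField K

  ∑ : ∀ {a} {A : Set a} → List A → (A → Carrier) → Carrier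
  ∑ xs f = foldr _+_ 0# (map f xs)

  affine : Carrier → Carrier → Carrier → Carrier
  affine a b x = a * x + b

module Traffic {c ℓ₁ ℓ₂ ℓ₃} (K : OrderedField c ℓ₁ ℓ₂ ℓ₃) (G : Digraph) where
  open OrderedField K
  open Scalars K
  open Digraph G
  open Path
  import Data.List.Membership.DecPropositional _≟ᴱ_ as DecMembership

  Flow : Set c
  Flow = Edge → Carrier

  Latency : Set c
  Latency = Edge → Carrier → Carrier

  outflow inflow : Flow → Vertex → Carrier
  outflow f v = ∑ (filter (λ e → src e ≟ⱽ v) edges) f
  inflow  f v = ∑ (filter (λ e → tgt e ≟ⱽ v) edges) f

  record IsFeasible (s t : Vertex) (q : Carrier) (f : Flow) : Set (c ⊔ ℓ₁ ⊔ ℓ₃) where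
    field
      nonneg       : ∀ e → 0# ≤ f e
      conservation : ∀ v → v ≢ s → v ≢ t → outflow f v ≈ inflow f v
      supply       : outflow f s - inflow f s ≈ q
      demand       : inflow f t - outflow f t ≈ q

  totalCost : Latency → Flow → Carrier
  totalCost ℓ f = ∑ edges λ e → f e * ℓ e (f e)

  pathLatency : ∀ {s t} → Latency → Flow → Path s t → Carrier
  pathLatency ℓ f p = ∑ (trail p) λ e → ℓ e (f e)

  PathFlow : Vertex → Vertex → Set c
  PathFlow s t = List (Path s t × Carrier)

  edgeFlow : ∀ {s t} → PathFlow s t → Flow
  edgeFlow xs e = ∑ (filter (λ (p , _) → e DecMembership.∈? trail p) xs) proj₂

  record IsUserEquilibrium (ℓ : Latency) (s t : Vertex) (q : Carrier) (f : Flow)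
                           : Set (c ⊔ ℓ₁ ⊔ ℓ₃) where
    field
      feasible        : IsFeasible s t q f
      pathFlow        : PathFlow s t
      pathFlow-nonneg : All (λ (_ , x) → 0# ≤ x) pathFlow
      decomposes      : ∀ e → f e ≈ edgeFlow pathFlow e
      wardrop         : All (λ (p , x) → 0# < x →
                               ∀ (p′ : Path s t) → pathLatency ℓ f p ≤ pathLatency ℓ f p′) pathFlow

module Electrical {c ℓ₁ ℓ₂ ℓ₃} (K : OrderedField c ℓ₁ ℓ₂ ℓ₃) (G : Digraph) where
  open OrderedField K
  open Scalars K
  open Digraph G

  Vector Matrix : Set c
  Vector = Vertex → Carrier
  Matrix = Vertex → Vertex → Carrier

  infix  8 _ᵀ
  infixl 7 _⊗_ _·_
  infixl 6 _⊖_
  infix  4 _≋_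

  _⊗_ : Matrix → Matrix → Matrix
  (A ⊗ B) x y = ∑ vertices λ z → A x z * B z y

  _·_ : Matrix → Vector → Vector
  (A · v) x = ∑ vertices λ y → A x y * v y

  dot : Vector → Vector → Carrier
  dot v w = ∑ vertices λ x → v x * w x

  _⊖_ : Vector → Vector → Vector
  (v ⊖ w) x = v x - w x

  basis : Vertex → Vector
  basis w x = if does (w ≟ⱽ x) then 1# else 0#

  _≋_ : Matrix → Matrix → Set ℓ₁
  A ≋ B = ∀ x y → A x y ≈ B x y

  _ᵀ : Matrix → Matrix
  (A ᵀ) x y = A y x

  -- The four Penrose equations, which determine A⁺ uniquely.
  record IsMoorePenroseInverse (A A⁺ : Matrix) : Set ℓ₁ where
    field
      AA⁺A≋A     : (A ⊗ A⁺) ⊗ A ≋ A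
      A⁺AA⁺≋A⁺   : (A⁺ ⊗ A) ⊗ A⁺ ≋ A⁺
      AA⁺-symm   : (A ⊗ A⁺) ᵀ ≋ A ⊗ A⁺
      A⁺A-symm   : (A⁺ ⊗ A) ᵀ ≋ A⁺ ⊗ A

  -- Laplacian of the underlying undirected graph, every edge having
  -- resistance r.
  laplacian : ∀ r → 0# < r → Matrix
  laplacian r 0<r u v =
    if does (u ≟ⱽ v) then multiple +-rawMonoid (degree u) (recip r 0<r)
    else if does (adjacent? u v) then - recip r 0<r
    else 0#
    where open CommutativeRing commutativeRing using (+-rawMonoid)

  -- q (e_s - e_t)ᵀ L⁺ (e_u - e_v), for L⁺ the pseudoinverse of the Laplacian.
  voltage : Carrier → Matrix → (s t u v : Vertex) → Carrier
  voltage q L⁺ s t u v = q * dot (basis s ⊖ basis t) (L⁺ · (basis u ⊖ basis v))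

{-# OPTIONS --safe #-}
module Submission where

-- Let φ solve L φ = e_s - e_t and let E = (q/a) dφ, where (dφ)(e) is the drop
-- of φ along the edge e.
-- The drop of φ along the horizontal edges is superharmonic, with Dirichlet
-- conditions in the horizontal and Neumann conditions in the vertical
-- direction, so it is nonnegative by the minimum principle; likewise for
-- the vertical edges. Hence E is feasible and can be compared with both
-- equilibria. By Thomson's principle C_old ≥ a ⟨E,E⟩ + b ∑E. Equilibrium
-- flow is routed along shortest paths, so C_new is at most the cost of
-- sending E at the new latencies, C_new ≤ a ⟨h,E⟩ + b ∑E, where h is the
-- new flow on the grid edges. As a E is a gradient and h - E has divergence
-- -z* (e_u - e_v), the difference a ⟨h - E,E⟩ equals -V_uv z*.
--
-- The order is not decidable, but ≤ is a negation, so that inequalities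
-- may be proved with minima that exist only up to double negation.

open import Algebra.Bundles using (CommutativeRing; RawRing)
open import Algebra.Definitions.RawMonoid using () renaming (_×_ to multiple)
import Algebra.Apartness.Properties.HeytingCommutativeRing as HeytingProperties
import Algebra.Properties.AbelianGroup
import Algebra.Properties.CommutativeSemigroup
import Algebra.Properties.Ring
import Algebra.Properties.Semiring.Mult.TCOptimised
import Algebra.Solver.Ring
open import Algebra.Solver.Ring.AlmostCommutativeRing using (_-Raw-AlmostCommutative⟶_; fromCommutativeRing)
open import Data.Bool.Base using (false; if_then_else_; true)
open import Data.Fin.Base using (Fin; fromℕ; inject₁; suc; toℕ; zero)
open import Data.Fin.Induction using (<-weakInduction; >-weakInduction)
import Data.Fin.Properties as Fin
open import Data.List.Base using (List; []; _++_; _∷_; allFin; cartesianProduct; cartesianProductWith; filter; length; map)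
open import Data.List.Membership.Propositional using (_∈_; _∉_)
open import Data.List.Membership.Propositional.Properties using (∈-allFin; ∈-cartesianProductWith⁺; ∈-cartesianProduct⁺)
import Data.List.Properties as List
open import Data.List.Relation.Unary.All as All using (All; []; _∷_)
open import Data.List.Relation.Unary.AllPairs using ([]; _∷_)
open import Data.List.Relation.Unary.Any using (here; there)
open import Data.List.Relation.Unary.Unique.Propositional using (Unique)
import Data.List.Relation.Unary.Unique.Propositional.Properties as Unique
open import Data.Maybe.Base using (Maybe; just; maybe; nothing)
open import Data.Nat.Base as ℕ using (ℕ; suc; zero) renaming (_≤_ to _≤ᴺ_)
import Data.Nat.Properties as ℕ
open import Data.Product.Base using (_,_; _×_; proj₁; proj₂; ∃; uncurry)
import Data.Product.Properties as Product
open import Data.Sum.Base as Sum using ([_,_]′; _⊎_; inj₁; inj₂)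
open import Data.Unit.Base using (tt; ⊤)
open import Defs
open import Function.Base using (case_of_; flip; id)
open import Function.Bundles using (_⇔_; mk⇔)
open import Level using (0ℓ; Level)
open import Relation.Binary.Bundles using (Poset)
open import Relation.Binary.Definitions using (DecidableEquality)
open import Relation.Binary.PropositionalEquality as ≡ using (_≡_; _≢_)
import Relation.Binary.Reasoning.PartialOrder
import Relation.Binary.Reasoning.Setoid
open import Relation.Binary.Structures using (module IsStrictPartialOrder)
open import Relation.Nullary using (Dec; does; no; yes; ¬_; ¬¬-excluded-middle)
open import Relation.Nullary.Decidable using (_×-dec_; _⊎-dec_; dec-false; dec-true; does-⇔)
open import Relation.Nullary.Negation using (contradiction)
open import Relation.Unary using (Decidable)

-- The cost of E at given latencies is at least q times the shortest latency because E is
-- nonnegative, whereas an electrical current may in general run against the direction of an edge.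
-- That it does not is due to s and t lying at opposite corners: the divergence of dφ is a (e_s -
-- e_t), which is at most 0 away from s and at least 0 away from t, and no edge ends in s or starts
-- in t. So the divergence never increases along an edge, and this is the superharmonicity of the
-- drops. The terms b ∑E match because every walk from s to t has m + n edges: all flows of q units
-- have the same sum over the grid edges, so b does not disturb Thomson's comparison. E leaves the
-- chord empty, so its cost at the new latencies involves the grid edges only.

-- The library's ring solver with formal differences of naturals as
-- coefficients, so that it can cancel in an arbitrary commutative ring.
module DifferenceSolver {c ℓ} (R : CommutativeRing c ℓ) where
  open CommutativeRing R
  open Algebra.Properties.Ring ring using (x[y-z]≈xy-xz; [y-z]x≈yx-zx; -0#≈0#)
  open Algebra.Properties.AbelianGroup +-abelianGroup using (⁻¹-∙-comm; ⁻¹-involutive)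
  open Algebra.Properties.CommutativeSemigroup +-commutativeSemigroup using (interchange)
  open Algebra.Properties.Semiring.Mult.TCOptimised semiring using (×-homo-+; ×1-homo-*) renaming (_×_ to _×ᴺ_)
  open Relation.Binary.Reasoning.Setoid setoid

  private
    differences : RawRing 0ℓ 0ℓ
    differences = record
      { Carrier = ℕ.ℕ × ℕ.ℕ
      ; _≈_     = _≡_
      ; _+_     = λ (m , n) (m′ , n′) → m ℕ.+ m′ , n ℕ.+ n′
      ; _*_     = λ (m , n) (m′ , n′) → m ℕ.* m′ ℕ.+ n ℕ.* n′ , m ℕ.* n′ ℕ.+ n ℕ.* m′
      ; -_      = λ (m , n) → n , m
      ; 0#      = 0 , 0
      ; 1#      = 1 , 0
      }

    value : ℕ.ℕ × ℕ.ℕ → Carrier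
    value (m , n) = m ×ᴺ 1# - n ×ᴺ 1#

    -‿interchange : ∀ x y z w → (x + y) - (z + w) ≈ (x - z) + (y - w)
    -‿interchange x y z w = trans (+-congˡ (sym (⁻¹-∙-comm z w))) (interchange x y (- z) (- w))

    -‿swap : ∀ x y → - (x - y) ≈ y - x
    -‿swap x y = begin
      - (x - y)     ≈⟨ ⁻¹-∙-comm x (- y) ⟨
      - x - - y     ≈⟨ +-congˡ (⁻¹-involutive y) ⟩
      - x + y       ≈⟨ +-comm (- x) y ⟩
      y - x         ∎

    product-of-differences : ∀ x y z w → (x * z + y * w) - (x * w + y * z) ≈ (x - y) * (z - w)
    product-of-differences x y z w = begin
      (x * z + y * w) - (x * w + y * z)     ≈⟨ -‿interchange (x * z) (y * w) (x * w) (y * z) ⟩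
      (x * z - x * w) + (y * w - y * z)     ≈⟨ +-congˡ (-‿swap (y * z) (y * w)) ⟨
      (x * z - x * w) - (y * z - y * w)     ≈⟨ +-cong (x[y-z]≈xy-xz x z w) (-‿cong (x[y-z]≈xy-xz y z w)) ⟨
      x * (z - w) - y * (z - w)             ≈⟨ [y-z]x≈yx-zx (z - w) x y ⟨
      (x - y) * (z - w)                     ∎

    cross-sum : ∀ {x y z w} → x + w ≈ z + y → x - y ≈ z - w
    cross-sum {x} {y} {z} {w} eq = begin
      x - y               ≈⟨ +-identityʳ _ ⟨
      (x - y) + 0#        ≈⟨ +-congˡ (-‿inverseʳ w) ⟨
      (x - y) + (w - w)   ≈⟨ -‿interchange x w y w ⟨
      (x + w) - (y + w)   ≈⟨ +-congʳ eq ⟩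
      (z + y) - (y + w)   ≈⟨ +-congʳ (+-comm z y) ⟩
      (y + z) - (y + w)   ≈⟨ -‿interchange y z y w ⟩
      (y - y) + (z - w)   ≈⟨ +-congʳ (-‿inverseʳ y) ⟩
      0# + (z - w)        ≈⟨ +-identityˡ _ ⟩
      z - w               ∎

    morphism : differences -Raw-AlmostCommutative⟶ fromCommutativeRing R
    morphism = record
      { ⟦_⟧    = value
      ; +-homo = λ (m , n) (m′ , n′) → trans
          (+-cong (×-homo-+ 1# m m′) (-‿cong (×-homo-+ 1# n n′)))
          (-‿interchange _ _ _ _)
      ; *-homo = λ (m , n) (m′ , n′) → trans
          (+-cong (trans (×-homo-+ 1# (m ℕ.* m′) (n ℕ.* n′)) (+-cong (×1-homo-* m m′) (×1-homo-* n n′)))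
                  (-‿cong (trans (×-homo-+ 1# (m ℕ.* n′) (n ℕ.* m′)) (+-cong (×1-homo-* m n′) (×1-homo-* n m′)))))
          (product-of-differences _ _ _ _)
      ; -‿homo = λ (m , n) → sym (-‿swap _ _)
      ; 0-homo = -‿inverseʳ 0#
      ; 1-homo = trans (+-congˡ -0#≈0#) (+-identityʳ 1#)
      }

    -- Formal differences are compared by cross-addition, so that different representatives of one
    -- integer, such as (1 , 1) and (0 , 0), are identified.
    equal? : ∀ x y → Maybe (value x ≈ value y)
    equal? (m , n) (m′ , n′) with m ℕ.+ n′ ℕ.≟ m′ ℕ.+ n
    ... | no  _  = nothing
    ... | yes eq = just (cross-sum (trans (sym (×-homo-+ 1# m n′))
                                     (trans (reflexive (≡.cong (_×ᴺ 1#) eq)) (×-homo-+ 1# m′ n))))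

  open Algebra.Solver.Ring differences (fromCommutativeRing R) morphism equal? public
    using (solve; _:=_; _:+_; _:*_; _:-_; :-_)

-- Arithmetic of an ordered field whose order is not decidable.

module OrderedFieldProperties {κ ℓ₁ ℓ₂ ℓ₃} (K : OrderedField κ ℓ₁ ℓ₂ ℓ₃) where
  open OrderedField K
  open HeytingProperties heytingCommutativeRing using (x-0≈x; invertibleʳ⇒#)
  open DifferenceSolver commutativeRing
  open IsStrictPartialOrder <-isStrictPartialOrder public
    using (<-respˡ-≈; <-respʳ-≈) renaming (irrefl to <-irrefl; trans to <-trans; asym to <-asym)

  ≤-reflexive : ∀ {x y} → x ≈ y → x ≤ y
  ≤-reflexive x≈y y<x = <-irrefl (sym x≈y) y<x

  -- Cotransitivity of apartness separates `z` from `x` or from `y`. Comparability then orders the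
  -- pair, and the wrong orders contradict `y ≤ z`. Transitivity of `≤` rests on this.
  <-≤-trans : ∀ {x y z} → x < y → y ≤ z → x < z
  <-≤-trans {x} {y} {z} x<y y≤z with #-cotrans (<⇒# x<y) z
  ... | inj₁ x#z with #⇒<⊎> x#z
  ...   | inj₁ x<z = x<z
  ...   | inj₂ z<x = contradiction (<-trans z<x x<y) y≤z
  <-≤-trans {x} {y} {z} x<y y≤z | inj₂ z#y with #⇒<⊎> z#y
  ...   | inj₁ z<y = contradiction z<y y≤z
  ...   | inj₂ y<z = <-trans x<y y<z

  ≤-trans : ∀ {x y z} → x ≤ y → y ≤ z → x ≤ z
  ≤-trans x≤y y≤z z<x = y≤z (<-≤-trans z<x x≤y)

  <⇒≤ : ∀ {x y} → x < y → x ≤ y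
  <⇒≤ = <-asym

  ≤-antisym : ∀ {x y} → x ≤ y → y ≤ x → x ≈ y
  ≤-antisym {x} {y} x≤y y≤x = proj₁ (tight x y) λ x#y → [ y≤x , x≤y ]′ (#⇒<⊎> x#y)

  ≤-poset : Poset κ ℓ₁ ℓ₃
  ≤-poset = record { isPartialOrder = record
    { isPreorder = record
      { isEquivalence = isEquivalence
      ; reflexive     = ≤-reflexive
      ; trans         = ≤-trans
      }
    ; antisym = ≤-antisym
    } }

  module ≤-Reasoning = Relation.Binary.Reasoning.PartialOrder ≤-poset
  module ≈-Reasoning = Relation.Binary.Reasoning.Setoid setoid

  ¬¬-trichotomy : ∀ x y → ¬ ¬ (x < y ⊎ x ≈ y ⊎ y < x)
  ¬¬-trichotomy x y ¬cmp = ¬cmp (inj₂ (inj₁ (≤-antisym (λ y<x → ¬cmp (inj₂ (inj₂ y<x))) (λ x<y → ¬cmp (inj₁ x<y)))))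

  ¬¬-total : ∀ x y → ¬ ¬ (x ≤ y ⊎ y ≤ x)
  ¬¬-total x y ¬tot = ¬tot (inj₁ λ y<x → ¬tot (inj₂ (<⇒≤ y<x)))

  +-monoʳ-< : ∀ z {x y} → x < y → z + x < z + y
  +-monoʳ-< z {x} {y} x<y = <-respˡ-≈ (+-comm x z) (<-respʳ-≈ (+-comm y z) (+-monoˡ-< z x<y))

  x≈y+[x-y] : ∀ x y → x ≈ y + (x - y)
  x≈y+[x-y] = solve 2 (λ x y → x := y :+ (x :- y)) refl

  x<y⇒0<y-x : ∀ {x y} → x < y → 0# < y - x
  x<y⇒0<y-x {x} {y} x<y = <-respˡ-≈ (-‿inverseʳ x) (+-monoˡ-< (- x) x<y)

  0<y-x⇒x<y : ∀ {x y} → 0# < y - x → x < y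
  0<y-x⇒x<y {x} {y} 0<y-x = <-respˡ-≈ (+-identityʳ x) (<-respʳ-≈ (sym (x≈y+[x-y] y x)) (+-monoʳ-< x 0<y-x))

  0≤y-x⇒x≤y : ∀ {x y} → 0# ≤ y - x → x ≤ y
  0≤y-x⇒x≤y {x} {y} 0≤y-x y<x = 0≤y-x (<-respʳ-≈ (-‿inverseʳ x) (+-monoˡ-< (- x) y<x))

  x≤y⇒0≤y-x : ∀ {x y} → x ≤ y → 0# ≤ y - x
  x≤y⇒0≤y-x {x} {y} x≤y y-x<0 = x≤y (0<y-x⇒x<y (<-respʳ-≈ (neg y x) (<-respʳ-≈ (+-identityˡ _) (x<y⇒0<y-x y-x<0))))
    where
    neg : ∀ y x → - (y - x) ≈ x - y
    neg = solve 2 (λ y x → :- (y :- x) := x :- y) refl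

  x≤y⇒x-y≤0 : ∀ {x y} → x ≤ y → x - y ≤ 0#
  x≤y⇒x-y≤0 {x} {y} x≤y 0<x-y = x≤y (0<y-x⇒x<y 0<x-y)

  +-mono-≤ : ∀ {x y z w} → x ≤ y → z ≤ w → x + z ≤ y + w
  +-mono-≤ {x} {y} {z} {w} x≤y z≤w = ≤-trans
    (λ lt → x≤y (<-respˡ-≈ (cancel y z) (<-respʳ-≈ (cancel x z) (+-monoˡ-< (- z) lt))))
    (λ lt → z≤w (<-respˡ-≈ (cancelˡ y w) (<-respʳ-≈ (cancelˡ y z) (+-monoʳ-< (- y) lt))))
    where
    cancel : ∀ x z → (x + z) - z ≈ x
    cancel = solve 2 (λ x z → (x :+ z) :- z := x) refl
    cancelˡ : ∀ x z → - x + (x + z) ≈ z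
    cancelˡ = solve 2 (λ x z → (:- x) :+ (x :+ z) := z) refl

  +-nonneg : ∀ {x y} → 0# ≤ x → 0# ≤ y → 0# ≤ x + y
  +-nonneg 0≤x 0≤y = ≤-trans (≤-reflexive (sym (+-identityʳ 0#))) (+-mono-≤ 0≤x 0≤y)

  *-nonneg : ∀ {x y} → 0# ≤ x → 0# ≤ y → 0# ≤ x * y
  *-nonneg {x} {y} 0≤x 0≤y xy<0 = ¬¬-trichotomy 0# x λ
    { (inj₂ (inj₂ x<0)) → 0≤x x<0
    ; (inj₂ (inj₁ 0≈x)) → <-irrefl (trans (*-congʳ (sym 0≈x)) (zeroˡ y)) xy<0
    ; (inj₁ 0<x) → ¬¬-trichotomy 0# y λ
      { (inj₂ (inj₂ y<0)) → 0≤y y<0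
      ; (inj₂ (inj₁ 0≈y)) → <-irrefl (trans (*-congˡ (sym 0≈y)) (zeroʳ x)) xy<0
      ; (inj₁ 0<y) → <-asym xy<0 (*-pos 0<x 0<y) } }

  *-monoˡ-≤ : ∀ {x y z} → 0# ≤ z → x ≤ y → z * x ≤ z * y
  *-monoˡ-≤ {x} {y} {z} 0≤z x≤y = 0≤y-x⇒x≤y
    (≤-trans (*-nonneg 0≤z (x≤y⇒0≤y-x x≤y)) (≤-reflexive (expand z y x)))
    where
    expand : ∀ z y x → z * (y - x) ≈ z * y - z * x
    expand = solve 3 (λ z y x → z :* (y :- x) := z :* y :- z :* x) refl

  neg-nonneg : ∀ {x} → x ≤ 0# → 0# ≤ - x
  neg-nonneg {x} x≤0 = ≤-trans (x≤y⇒0≤y-x x≤0) (≤-reflexive (+-identityˡ (- x)))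

  neg² : ∀ x → - x * - x ≈ x * x
  neg² = solve 1 (λ x → (:- x) :* (:- x) := x :* x) refl

  square-nonneg : ∀ x → 0# ≤ x * x
  square-nonneg x xx<0 = ¬¬-total 0# x λ
    { (inj₁ 0≤x) → *-nonneg 0≤x 0≤x xx<0
    ; (inj₂ x≤0) → ≤-trans (*-nonneg (neg-nonneg x≤0) (neg-nonneg x≤0)) (≤-reflexive (neg² x)) xx<0 }

  square≈0⇒≈0 : ∀ {x} → x * x ≈ 0# → x ≈ 0#
  square≈0⇒≈0 {x} xx≈0 = ≤-antisym
    (λ 0<x → <-irrefl (sym xx≈0) (*-pos 0<x 0<x))
    (λ x<0 → let 0<-x = <-respʳ-≈ (+-identityˡ (- x)) (x<y⇒0<y-x x<0) in
             <-irrefl (sym (trans (neg² x) xx≈0)) (*-pos 0<-x 0<-x))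

  0≤1 : 0# ≤ 1#
  0≤1 = ≤-trans (square-nonneg 1#) (≤-reflexive (*-identityˡ 1#))

  recip-inverse : ∀ x 0<x → x * recip x 0<x ≈ 1#
  recip-inverse x 0<x = trans (*-congʳ (sym (x-0≈x x))) (proj₂ (proj₂ (#⇒invertible (#-sym (<⇒# 0<x)))))

  -- A negative reciprocal `r` would make `x * - r` positive, but this product is minus one.
  recip-nonneg : ∀ x 0<x → 0# ≤ recip x 0<x
  recip-nonneg x 0<x r<0 = 0≤1 (<-respˡ-≈ (neg-rx) (<-respʳ-≈ (-‿inverseˡ _) (+-monoʳ-< (- (x * - r)) 0<x*-r)))
    where
    r = recip x 0<x
    0<x*-r : 0# < x * - r
    0<x*-r = *-pos 0<x (<-respʳ-≈ (+-identityˡ (- r)) (x<y⇒0<y-x r<0))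
    neg-rx : - (x * - r) + 0# ≈ 1#
    neg-rx = trans (+-identityʳ _) (trans (eq x r) (recip-inverse x 0<x))
      where
      eq : ∀ x r → - (x * - r) ≈ x * r
      eq = solve 2 (λ x r → :- (x :* (:- r)) := x :* r) refl

  -- A positive product makes its factors invertible, hence apart from 0.
  0<-xy⇒x<0 : ∀ {x y} → 0# ≤ y → 0# < - (x * y) → x < 0#
  0<-xy⇒x<0 {x} {y} 0≤y 0<-xy with #⇒<⊎> (invertibleʳ⇒# {x} {0#} (- y * r , inverse))
    where
    r = recip (- (x * y)) 0<-xy
    rearrange : ∀ x y r → x * (- y * r) ≈ - (x * y) * r
    rearrange = solve 3 (λ x y r → x :* ((:- y) :* r) := (:- (x :* y)) :* r) refl
    inverse : (x - 0#) * (- y * r) ≈ 1#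
    inverse = trans (*-congʳ (x-0≈x x)) (trans (rearrange x y r) (recip-inverse _ 0<-xy))
  ... | inj₁ x<0 = x<0
  ... | inj₂ 0<x = contradiction
    (<-respʳ-≈ (-‿inverseʳ (x * y)) (<-respˡ-≈ (+-identityʳ _) (+-monoʳ-< (x * y) 0<-xy)))
    (*-nonneg (<⇒≤ 0<x) 0≤y)

-- Finite sums and indicators.

module Sums {κ ℓ₁ ℓ₂ ℓ₃} (K : OrderedField κ ℓ₁ ℓ₂ ℓ₃) where
  open OrderedField K
  open Scalars K
  open CommutativeRing commutativeRing using (+-rawMonoid; +-commutativeSemigroup)
  open Algebra.Properties.CommutativeSemigroup +-commutativeSemigroup using (interchange)
  open OrderedFieldProperties K
  open DifferenceSolver commutativeRing

  -- The Iverson bracket. `basis w x` unfolds to `⟦ w ≟ⱽ x ⟧`, so sums over filtered edges and the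
  -- linear algebra share one calculus.
  ⟦_⟧ : ∀ {p} {P : Set p} → Dec P → Carrier
  ⟦ P? ⟧ = if does P? then 1# else 0#

  ⟦⟧-true : ∀ {p} {P : Set p} (P? : Dec P) → P → ⟦ P? ⟧ ≈ 1#
  ⟦⟧-true P? p = reflexive (≡.cong (if_then 1# else 0#) (dec-true P? p))

  ⟦⟧-false : ∀ {p} {P : Set p} (P? : Dec P) → ¬ P → ⟦ P? ⟧ ≈ 0#
  ⟦⟧-false P? ¬p = reflexive (≡.cong (if_then 1# else 0#) (dec-false P? ¬p))

  ⟦⟧-cong : ∀ {p q} {P : Set p} {Q : Set q} (P? : Dec P) (Q? : Dec Q) → P ⇔ Q → ⟦ P? ⟧ ≈ ⟦ Q? ⟧
  ⟦⟧-cong P? Q? P⇔Q = reflexive (≡.cong (if_then 1# else 0#) (does-⇔ P⇔Q P? Q?))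

  ⟦⟧-× : ∀ {p q} {P : Set p} {Q : Set q} (P? : Dec P) (Q? : Dec Q) → ⟦ P? ×-dec Q? ⟧ ≈ ⟦ P? ⟧ * ⟦ Q? ⟧
  ⟦⟧-× P? Q? with does P?
  ... | true  = sym (*-identityˡ _)
  ... | false = sym (zeroˡ _)

  ⟦⟧-⊎ : ∀ {p q} {P : Set p} {Q : Set q} (P? : Dec P) (Q? : Dec Q) → ¬ (P × Q) →
         ⟦ P? ⊎-dec Q? ⟧ ≈ ⟦ P? ⟧ + ⟦ Q? ⟧
  ⟦⟧-⊎ (yes p) Q? ¬pq = sym (trans (+-congˡ (⟦⟧-false Q? (λ q → ¬pq (p , q)))) (+-identityʳ 1#))
  ⟦⟧-⊎ (no _)  Q? ¬pq = sym (+-identityˡ _)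

  ⟦⟧-support : ∀ {p} {P : Set p} (P? : Dec P) {x y} → (P → x ≈ y) → ⟦ P? ⟧ * x ≈ ⟦ P? ⟧ * y
  ⟦⟧-support (yes p) x≈y = *-congˡ (x≈y p)
  ⟦⟧-support (no ¬p) x≈y = trans (zeroˡ _) (sym (zeroˡ _))

  private variable
    α β : Level
    A : Set α
    B : Set β

  ∑-cong : ∀ (xs : List A) {f g : A → Carrier} → (∀ x → f x ≈ g x) → ∑ xs f ≈ ∑ xs g
  ∑-cong []       f≈g = refl
  ∑-cong (x ∷ xs) f≈g = +-cong (f≈g x) (∑-cong xs f≈g)

  ∑-zero : ∀ (xs : List A) {f : A → Carrier} → (∀ x → f x ≈ 0#) → ∑ xs f ≈ 0#
  ∑-zero []       f≈0 = refl
  ∑-zero (x ∷ xs) f≈0 = trans (+-cong (f≈0 x) (∑-zero xs f≈0)) (+-identityʳ 0#)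

  ∑-distrib-+ : ∀ (xs : List A) (f g : A → Carrier) → ∑ xs (λ x → f x + g x) ≈ ∑ xs f + ∑ xs g
  ∑-distrib-+ []       f g = sym (+-identityʳ 0#)
  ∑-distrib-+ (x ∷ xs) f g = trans (+-congˡ (∑-distrib-+ xs f g)) (interchange _ _ _ _)

  *-distribˡ-∑ : ∀ (xs : List A) a (f : A → Carrier) → a * ∑ xs f ≈ ∑ xs (λ x → a * f x)
  *-distribˡ-∑ []       a f = zeroʳ a
  *-distribˡ-∑ (x ∷ xs) a f = trans (distribˡ _ _ _) (+-congˡ (*-distribˡ-∑ xs a f))

  *-distribʳ-∑ : ∀ (xs : List A) a (f : A → Carrier) → ∑ xs f * a ≈ ∑ xs (λ x → f x * a)
  *-distribʳ-∑ xs a f = trans (*-comm _ a) (trans (*-distribˡ-∑ xs a f) (∑-cong xs λ x → *-comm a (f x)))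

  ∑-distrib-minus : ∀ (xs : List A) (f g : A → Carrier) → ∑ xs (λ x → f x - g x) ≈ ∑ xs f - ∑ xs g
  ∑-distrib-minus []       f g = sym (-‿inverseʳ 0#)
  ∑-distrib-minus (x ∷ xs) f g = trans (+-congˡ (∑-distrib-minus xs f g))
    (solve 4 (λ a b c d → (a :- b) :+ (c :- d) := (a :+ c) :- (b :+ d)) refl _ _ _ _)

  ∑-swap : ∀ (xs : List A) (ys : List B) (f : A → B → Carrier) →
           ∑ xs (λ x → ∑ ys (f x)) ≈ ∑ ys (λ y → ∑ xs (λ x → f x y))
  ∑-swap []       ys f = sym (∑-zero ys λ _ → refl)
  ∑-swap (x ∷ xs) ys f = trans (+-congˡ (∑-swap xs ys f)) (sym (∑-distrib-+ ys (f x) _))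

  ∑-++ : ∀ (xs ys : List A) (f : A → Carrier) → ∑ (xs ++ ys) f ≈ ∑ xs f + ∑ ys f
  ∑-++ []       ys f = sym (+-identityˡ _)
  ∑-++ (x ∷ xs) ys f = trans (+-congˡ (∑-++ xs ys f)) (sym (+-assoc _ _ _))

  ∑-map : ∀ (h : A → B) (xs : List A) (f : B → Carrier) → ∑ (map h xs) f ≈ ∑ xs (λ x → f (h x))
  ∑-map h []       f = refl
  ∑-map h (x ∷ xs) f = +-congˡ (∑-map h xs f)

  ∑-cartesianProduct : ∀ (xs : List A) (ys : List B) (f : A × B → Carrier) →
                       ∑ (cartesianProduct xs ys) f ≈ ∑ xs (λ x → ∑ ys (λ y → f (x , y)))
  ∑-cartesianProduct []       ys f = refl
  ∑-cartesianProduct (x ∷ xs) ys f = trans (∑-++ (map (x ,_) ys) _ f)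
    (+-cong (∑-map (x ,_) ys f) (∑-cartesianProduct xs ys f))

  ∑-filter : ∀ {p} {P : A → Set p} (P? : Decidable P) xs (f : A → Carrier) →
             ∑ (filter P? xs) f ≈ ∑ xs (λ x → ⟦ P? x ⟧ * f x)
  ∑-filter P? []       f = refl
  ∑-filter P? (x ∷ xs) f with does (P? x)
  ... | true  = +-cong (sym (*-identityˡ _)) (∑-filter P? xs f)
  ... | false = trans (∑-filter P? xs f) (sym (trans (+-congʳ (zeroˡ _)) (+-identityˡ _)))

  multiple-length-filter : ∀ {p} {P : A → Set p} (P? : Decidable P) xs r →
                           multiple +-rawMonoid (length (filter P? xs)) r ≈ ∑ xs (λ x → ⟦ P? x ⟧ * r)
  multiple-length-filter P? xs r = trans (multiple≈∑ (filter P? xs)) (∑-filter P? xs λ _ → r)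
    where
    multiple≈∑ : ∀ ys → multiple +-rawMonoid (length ys) r ≈ ∑ ys (λ _ → r)
    multiple≈∑ []       = refl
    multiple≈∑ (_ ∷ ys) = +-congˡ (multiple≈∑ ys)

  ∑-zero-∉ : ∀ {y : A} (xs : List A) {f} → y ∉ xs → (∀ x → x ≢ y → f x ≈ 0#) → ∑ xs f ≈ 0#
  ∑-zero-∉ []       y∉xs f≈0 = refl
  ∑-zero-∉ (x ∷ xs) y∉xs f≈0 = trans
    (+-cong (f≈0 x λ { ≡.refl → y∉xs (here ≡.refl) }) (∑-zero-∉ xs (λ y∈ → y∉xs (there y∈)) f≈0))
    (+-identityʳ 0#)

  ∑-point : ∀ {y : A} (xs : List A) {f} → Unique xs → y ∈ xs → (∀ x → x ≢ y → f x ≈ 0#) → ∑ xs f ≈ f y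
  ∑-point (x ∷ xs) u@(_ ∷ _) (here ≡.refl) f≈0 =
    trans (+-congˡ (∑-zero-∉ xs (Unique.Unique[x∷xs]⇒x∉xs u) f≈0)) (+-identityʳ _)
  ∑-point (x ∷ xs) (x∉ ∷ u) (there y∈xs) f≈0 =
    trans (+-cong (f≈0 x (All.lookup x∉ y∈xs)) (∑-point xs u y∈xs f≈0)) (+-identityˡ _)

  ∑-indicator : ∀ (_≟_ : DecidableEquality A) {y} (xs : List A) → Unique xs → y ∈ xs → ∀ (f : A → Carrier) →
                ∑ xs (λ x → ⟦ y ≟ x ⟧ * f x) ≈ f y
  ∑-indicator _≟_ {y} xs u y∈xs f = trans
    (∑-point xs u y∈xs λ x x≢y → trans (*-congʳ (⟦⟧-false (y ≟ x) (λ y≡x → x≢y (≡.sym y≡x)))) (zeroˡ _))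
    (trans (*-congʳ (⟦⟧-true (y ≟ y) ≡.refl)) (*-identityˡ _))

  -- The bound is asked of the listed entries only, because Wardrop's condition is available only
  -- for the listed paths.
  ∑-mono : ∀ (xs : List A) {f g : A → Carrier} → All (λ x → f x ≤ g x) xs → ∑ xs f ≤ ∑ xs g
  ∑-mono []       []            = ≤-reflexive refl
  ∑-mono (x ∷ xs) (fx≤gx ∷ f≤g) = +-mono-≤ fx≤gx (∑-mono xs f≤g)

  ∑-nonneg : ∀ (xs : List A) {f : A → Carrier} → (∀ x → 0# ≤ f x) → 0# ≤ ∑ xs f
  ∑-nonneg []       0≤f = ≤-reflexive refl
  ∑-nonneg (x ∷ xs) 0≤f = +-nonneg (0≤f x) (∑-nonneg xs 0≤f)

  ∑-nonneg-≈0 : ∀ (xs : List A) {f : A → Carrier} → (∀ x → 0# ≤ f x) → ∑ xs f ≈ 0# →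
                ∀ {x} → x ∈ xs → f x ≈ 0#
  ∑-nonneg-≈0 (y ∷ xs) {f} 0≤f sum≈0 {x} x∈ = go x∈
    where
    vanish : ∀ {a b} → 0# ≤ a → 0# ≤ b → a + b ≈ 0# → a ≈ 0#
    vanish 0≤a 0≤b a+b≈0 = ≤-antisym
      (≤-trans (≤-reflexive (sym (+-identityʳ _)))
        (≤-trans (+-mono-≤ (≤-reflexive refl) 0≤b) (≤-reflexive a+b≈0)))
      0≤a
    go : x ∈ y ∷ xs → f x ≈ 0#
    go (here ≡.refl) = vanish (0≤f y) (∑-nonneg xs {f} 0≤f) sum≈0
    go (there x∈xs)  = ∑-nonneg-≈0 xs {f} 0≤f
      (vanish (∑-nonneg xs {f} 0≤f) (0≤f y) (trans (+-comm _ _) sum≈0)) x∈xs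

-- Divergence, potentials and the cost of an equilibrium.

module Networks {κ ℓ₁ ℓ₂ ℓ₃} (K : OrderedField κ ℓ₁ ℓ₂ ℓ₃) (G : Digraph) where
  open OrderedField K
  open Scalars K
  open OrderedFieldProperties K
  open DifferenceSolver commutativeRing
  open Sums K
  open Digraph G
  open Traffic K G
  open Electrical K G
  open Path
  open HeytingProperties heytingCommutativeRing using (x-0≈x)
  import Data.List.Membership.DecPropositional _≟ᴱ_ as DecMembership

  divergence : Flow → Vertex → Carrier
  divergence f v = outflow f v - inflow f v

  drop : Vector → Flow
  drop ψ e = ψ (src e) - ψ (tgt e)

  divergence-∑ : ∀ f v → divergence f v ≈ ∑ edges λ e → (basis (src e) v - basis (tgt e) v) * f e
  divergence-∑ f v = begin
    outflow f v - inflow f v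
      ≈⟨ +-cong (∑-filter (λ e → src e ≟ⱽ v) edges f) (-‿cong (∑-filter (λ e → tgt e ≟ⱽ v) edges f)) ⟩
    ∑ edges (λ e → ⟦ src e ≟ⱽ v ⟧ * f e) - ∑ edges (λ e → ⟦ tgt e ≟ⱽ v ⟧ * f e)
      ≈⟨ ∑-distrib-minus edges _ _ ⟨
    ∑ edges (λ e → ⟦ src e ≟ⱽ v ⟧ * f e - ⟦ tgt e ≟ⱽ v ⟧ * f e)
      ≈⟨ ∑-cong edges (λ e → solve 3 (λ a b c → a :* c :- b :* c := (a :- b) :* c) refl _ _ _) ⟩
    ∑ edges (λ e → (basis (src e) v - basis (tgt e) v) * f e) ∎
    where open ≈-Reasoning

  dot-basis : ∀ w ψ → dot (basis w) ψ ≈ ψ w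
  dot-basis w ψ = ∑-indicator _≟ⱽ_ vertices vertices-unique (vertices-complete w) ψ

  dot-basis-⊖ : ∀ u v ψ → dot (basis u ⊖ basis v) ψ ≈ ψ u - ψ v
  dot-basis-⊖ u v ψ = begin
    ∑ vertices (λ x → (basis u x - basis v x) * ψ x)
      ≈⟨ ∑-cong vertices (λ x → solve 3 (λ a b c → (a :- b) :* c := a :* c :- b :* c) refl _ _ _) ⟩
    ∑ vertices (λ x → basis u x * ψ x - basis v x * ψ x)
      ≈⟨ ∑-distrib-minus vertices _ _ ⟩
    dot (basis u) ψ - dot (basis v) ψ
      ≈⟨ +-cong (dot-basis u ψ) (-‿cong (dot-basis v ψ)) ⟩
    ψ u - ψ v ∎
    where open ≈-Reasoning

  -- `drop` and `divergence` are adjoint: both sides are the double sum of `f`, `ψ` and the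
  -- incidence matrix `basis (src e) v - basis (tgt e) v`, summed in the two possible orders.
  summation-by-parts : ∀ f ψ → ∑ edges (λ e → f e * drop ψ e) ≈ dot (divergence f) ψ
  summation-by-parts f ψ = begin
    ∑ edges (λ e → f e * drop ψ e)
      ≈⟨ ∑-cong edges (λ e → *-congˡ (dot-basis-⊖ (src e) (tgt e) ψ)) ⟨
    ∑ edges (λ e → f e * ∑ vertices (λ v → (basis (src e) v - basis (tgt e) v) * ψ v))
      ≈⟨ ∑-cong edges (λ e → *-distribˡ-∑ vertices (f e) _) ⟩
    ∑ edges (λ e → ∑ vertices (λ v → f e * ((basis (src e) v - basis (tgt e) v) * ψ v)))
      ≈⟨ ∑-swap edges vertices _ ⟩
    ∑ vertices (λ v → ∑ edges (λ e → f e * ((basis (src e) v - basis (tgt e) v) * ψ v)))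
      ≈⟨ ∑-cong vertices (λ v → ∑-cong edges (λ e →
           solve 3 (λ a b c → a :* (b :* c) := (b :* a) :* c) refl _ _ _)) ⟩
    ∑ vertices (λ v → ∑ edges (λ e → (basis (src e) v - basis (tgt e) v) * f e * ψ v))
      ≈⟨ ∑-cong vertices (λ v → *-distribʳ-∑ edges (ψ v) _) ⟨
    ∑ vertices (λ v → ∑ edges (λ e → (basis (src e) v - basis (tgt e) v) * f e) * ψ v)
      ≈⟨ ∑-cong vertices (λ v → *-congʳ (divergence-∑ f v)) ⟨
    dot (divergence f) ψ ∎
    where open ≈-Reasoning

  -- The balance conditions merge into one equation between vectors, the form that can be paired
  -- with an arbitrary potential.
  feasible-divergence : ∀ {s t q f} → s ≢ t → IsFeasible s t q f →
                        ∀ v → divergence f v ≈ q * (basis s v - basis t v)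
  feasible-divergence {s} {t} {q} {f} s≢t feasible v = by-cases (s ≟ⱽ v) (t ≟ⱽ v) ≡.refl ≡.refl
    where
    open IsFeasible feasible
    by-cases : (s≟v : Dec (s ≡ v)) (t≟v : Dec (t ≡ v)) → s ≟ⱽ v ≡ s≟v → t ≟ⱽ v ≡ t≟v →
               divergence f v ≈ q * (⟦ s ≟ⱽ v ⟧ - ⟦ t ≟ⱽ v ⟧)
    by-cases (yes ≡.refl) (yes ≡.refl) _ _ = contradiction ≡.refl s≢t
    by-cases (yes ≡.refl) (no _) eq₁ eq₂ rewrite eq₁ | eq₂ =
      trans supply (sym (trans (*-congˡ (x-0≈x 1#)) (*-identityʳ q)))
    by-cases (no _) (yes ≡.refl) eq₁ eq₂ rewrite eq₁ | eq₂ = begin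
      divergence f v                ≈⟨ solve 2 (λ a b → a :- b := :- (b :- a)) refl _ _ ⟩
      - (inflow f v - outflow f v)  ≈⟨ -‿cong demand ⟩
      - q                           ≈⟨ -‿cong (*-identityʳ q) ⟨
      - (q * 1#)                    ≈⟨ solve 2 (λ q a → :- (q :* a) := q :* ((q :- q) :- a)) refl q 1# ⟩
      q * ((q - q) - 1#)            ≈⟨ *-congˡ (+-congʳ (-‿inverseʳ q)) ⟩
      q * (0# - 1#)                 ∎
      where open ≈-Reasoning
    by-cases (no s≢v) (no t≢v) eq₁ eq₂ rewrite eq₁ | eq₂ = begin
      divergence f v          ≈⟨ +-congʳ (conservation v (λ v≡s → s≢v (≡.sym v≡s)) (λ v≡t → t≢v (≡.sym v≡t))) ⟩
      inflow f v - inflow f v ≈⟨ -‿inverseʳ _ ⟩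
      0#                      ≈⟨ zeroʳ q ⟨
      q * 0#                  ≈⟨ *-congˡ (-‿inverseʳ 0#) ⟨
      q * (0# - 0#)           ∎
      where open ≈-Reasoning

  -- Each of the `q` units descends from `ψ s` to `ψ t`, whatever its route.
  flow-drop : ∀ {s t q f} → (∀ v → divergence f v ≈ q * (basis s v - basis t v)) →
              ∀ ψ → ∑ edges (λ e → f e * drop ψ e) ≈ q * (ψ s - ψ t)
  flow-drop {s} {t} {q} {f} div-f ψ = begin
    ∑ edges (λ e → f e * drop ψ e)                             ≈⟨ summation-by-parts f ψ ⟩
    ∑ vertices (λ v → divergence f v * ψ v)                    ≈⟨ ∑-cong vertices (λ v → trans (*-congʳ (div-f v)) (*-assoc _ _ _)) ⟩
    ∑ vertices (λ v → q * ((basis s v - basis t v) * ψ v))     ≈⟨ *-distribˡ-∑ vertices q _ ⟨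
    q * dot (basis s ⊖ basis t) ψ                              ≈⟨ *-congˡ (dot-basis-⊖ s t ψ) ⟩
    q * (ψ s - ψ t)                                            ∎
    where open ≈-Reasoning

  walk-drop : ∀ {u w} ψ es → IsWalk u es w → ∑ es (drop ψ) ≈ ψ u - ψ w
  walk-drop ψ []       ≡.refl          = sym (-‿inverseʳ _)
  walk-drop ψ (e ∷ es) (≡.refl , walk) = trans (+-congˡ (walk-drop ψ es walk))
    (solve 3 (λ a b c → (a :- b) :+ (b :- c) := a :- c) refl _ _ _)

  trail-unique : ∀ {u w} (p : Path u w) → Unique (trail p)
  trail-unique p with simple p
  ... | _ ∷ u = Unique.map⁻ u

  -- Membership counts an edge once, while `∑ es x` counts every occurrence; uniqueness reconciles
  -- the two.
  ∑-edges-∈ : ∀ es → Unique es → ∀ x → ∑ edges (λ e → ⟦ e DecMembership.∈? es ⟧ * x e) ≈ ∑ es x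
  ∑-edges-∈ []       _ x = ∑-zero edges λ e → zeroˡ (x e)
  ∑-edges-∈ (e′ ∷ es) u@(_ ∷ u′) x = begin
    ∑ edges (λ e → ⟦ e DecMembership.∈? (e′ ∷ es) ⟧ * x e)
      ≈⟨ ∑-cong edges (λ e → trans (*-congʳ (split e)) (distribʳ _ _ _)) ⟩
    ∑ edges (λ e → ⟦ e′ ≟ᴱ e ⟧ * x e + ⟦ e DecMembership.∈? es ⟧ * x e)
      ≈⟨ ∑-distrib-+ edges _ _ ⟩
    ∑ edges (λ e → ⟦ e′ ≟ᴱ e ⟧ * x e) + ∑ edges (λ e → ⟦ e DecMembership.∈? es ⟧ * x e)
      ≈⟨ +-cong (∑-indicator _≟ᴱ_ edges edges-unique (edges-complete e′) x) (∑-edges-∈ es u′ x) ⟩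
    x e′ + ∑ es x ∎
    where
    open ≈-Reasoning
    split : ∀ e → ⟦ e DecMembership.∈? (e′ ∷ es) ⟧ ≈ ⟦ e′ ≟ᴱ e ⟧ + ⟦ e DecMembership.∈? es ⟧
    split e = trans
      (⟦⟧-cong (e DecMembership.∈? (e′ ∷ es)) ((e′ ≟ᴱ e) ⊎-dec (e DecMembership.∈? es))
        (mk⇔ (λ { (here e≡e′) → inj₁ (≡.sym e≡e′) ; (there e∈) → inj₂ e∈ })
             (λ { (inj₁ e′≡e) → here (≡.sym e′≡e) ; (inj₂ e∈) → there e∈ })))
      (⟦⟧-⊎ (e′ ≟ᴱ e) (e DecMembership.∈? es)
        (λ { (≡.refl , e∈) → Unique.Unique[x∷xs]⇒x∉xs u e∈ }))

  ∑-edgeFlow : ∀ {s t} (xs : PathFlow s t) x →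
               ∑ edges (λ e → edgeFlow xs e * x e) ≈ ∑ xs (λ (p , y) → y * ∑ (trail p) x)
  ∑-edgeFlow xs x = begin
    ∑ edges (λ e → edgeFlow xs e * x e)
      ≈⟨ ∑-cong edges (λ e → *-congʳ (∑-filter (λ (p , _) → e DecMembership.∈? trail p) xs proj₂)) ⟩
    ∑ edges (λ e → ∑ xs (λ (p , y) → ⟦ e DecMembership.∈? trail p ⟧ * y) * x e)
      ≈⟨ ∑-cong edges (λ e → *-distribʳ-∑ xs (x e) _) ⟩
    ∑ edges (λ e → ∑ xs (λ (p , y) → ⟦ e DecMembership.∈? trail p ⟧ * y * x e))
      ≈⟨ ∑-swap edges xs _ ⟩
    ∑ xs (λ (p , y) → ∑ edges (λ e → ⟦ e DecMembership.∈? trail p ⟧ * y * x e))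
      ≈⟨ ∑-cong xs (λ (p , y) → ∑-cong edges (λ e →
           solve 3 (λ a b c → a :* b :* c := b :* (a :* c)) refl _ _ _)) ⟩
    ∑ xs (λ (p , y) → ∑ edges (λ e → y * (⟦ e DecMembership.∈? trail p ⟧ * x e)))
      ≈⟨ ∑-cong xs (λ (p , y) → *-distribˡ-∑ edges y _) ⟨
    ∑ xs (λ (p , y) → y * ∑ edges (λ e → ⟦ e DecMembership.∈? trail p ⟧ * x e))
      ≈⟨ ∑-cong xs (λ (p , y) → *-congˡ (∑-edges-∈ (trail p) (trail-unique p) x)) ⟩
    ∑ xs (λ (p , y) → y * ∑ (trail p) x) ∎
    where open ≈-Reasoning

  -- The cost splits over the paths of the decomposition, and no path in use is slower than `p`.
  equilibrium-cost-≤ : ∀ {ℓ s t q f} → s ≢ t → IsUserEquilibrium ℓ s t q f →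
                       ∀ p → totalCost ℓ f ≤ q * pathLatency ℓ f p
  equilibrium-cost-≤ {ℓ} {s} {t} {q} {f} s≢t equilibrium p = begin
    ∑ edges (λ e → f e * ℓ e (f e))                  ≈⟨ ∑-paths (λ e → ℓ e (f e)) ⟩
    ∑ pathFlow (λ (p , y) → y * pathLatency ℓ f p)
      ≤⟨ ∑-mono pathFlow (All.zipWith (λ {(p′ , _)} (0≤y , shortest) → shorter p′ 0≤y shortest) (pathFlow-nonneg , wardrop)) ⟩
    ∑ pathFlow (λ (_ , y) → y * pathLatency ℓ f p)   ≈⟨ *-distribʳ-∑ pathFlow _ proj₂ ⟨
    ∑ pathFlow proj₂ * pathLatency ℓ f p             ≈⟨ *-congʳ total-path-flow ⟩
    q * pathLatency ℓ f p                            ∎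
    where
    open IsUserEquilibrium equilibrium
    open ≤-Reasoning

    ∑-paths : ∀ x → ∑ edges (λ e → f e * x e) ≈ ∑ pathFlow (λ (p , y) → y * ∑ (trail p) x)
    ∑-paths x = trans (∑-cong edges λ e → *-congʳ (decomposes e)) (∑-edgeFlow pathFlow x)

    basis-s-drop : basis s s - basis s t ≈ 1#
    basis-s-drop = trans (+-cong (⟦⟧-true (s ≟ⱽ s) ≡.refl) (-‿cong (⟦⟧-false (s ≟ⱽ t) s≢t)))
                         (x-0≈x 1#)

    -- As a potential, `basis s` drops by 1 along every path from `s` to `t`. Pairing `f` with this
    -- drop yields the total path flow when computed by paths, and `q` when computed by divergence.
    total-path-flow : ∑ pathFlow proj₂ ≈ q
    total-path-flow = begin-equality
      ∑ pathFlow proj₂                                               ≈⟨ ∑-cong pathFlow (λ (p , y) → trans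
                                                                          (*-congˡ (trans (walk-drop (basis s) (trail p) (isWalk p)) basis-s-drop))
                                                                          (*-identityʳ y)) ⟨
      ∑ pathFlow (λ (p , y) → y * ∑ (trail p) (drop (basis s)))      ≈⟨ ∑-paths (drop (basis s)) ⟨
      ∑ edges (λ e → f e * drop (basis s) e)                         ≈⟨ flow-drop (feasible-divergence s≢t feasible) (basis s) ⟩
      q * (basis s s - basis s t)                                    ≈⟨ *-congˡ basis-s-drop ⟩
      q * 1#                                                         ≈⟨ *-identityʳ q ⟩
      q                                                              ∎

    -- Wardrop's condition covers positive amounts only; for amount 0 both sides vanish. The case
    -- distinction is legitimate because the goal is a negation.
    shorter : ∀ p′ {y} → 0# ≤ y → (0# < y → ∀ p → pathLatency ℓ f p′ ≤ pathLatency ℓ f p) →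
              y * pathLatency ℓ f p′ ≤ y * pathLatency ℓ f p
    shorter p′ {y} 0≤y shortest lt = ¬¬-trichotomy 0# y λ
      { (inj₁ 0<y)        → *-monoˡ-≤ 0≤y (shortest 0<y p) lt
      ; (inj₂ (inj₁ 0≈y)) → <-irrefl (trans (*-congʳ (sym 0≈y)) (trans (zeroˡ _) (sym (trans (*-congʳ (sym 0≈y)) (zeroˡ _))))) lt
      ; (inj₂ (inj₂ y<0)) → 0≤y y<0 }

-- The Laplacian as divergence of a gradient, and its energy form.

module Laplacians {κ ℓ₁ ℓ₂ ℓ₃} (K : OrderedField κ ℓ₁ ℓ₂ ℓ₃) (G : Digraph)
  (loopless : ∀ e → Digraph.src G e ≢ Digraph.tgt G e)
  (simple : ∀ {e e′ u v} → Digraph.Joins G e u v → Digraph.Joins G e′ u v → e ≡ e′)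
  (a : OrderedField.Carrier K) (0<a : OrderedField._<_ K (OrderedField.0# K) a) where
  open OrderedField K
  open CommutativeRing commutativeRing using (ring; +-rawMonoid)
  open Scalars K
  open OrderedFieldProperties K
  open DifferenceSolver commutativeRing
  open Sums K
  open Digraph G
  open Electrical K G
  open Networks K G
  open Algebra.Properties.Ring ring using (-0#≈0#)
  open HeytingProperties heytingCommutativeRing using (x-0≈x)

  private
    r : Carrier
    r = recip a 0<a

    L : Matrix
    L = laplacian a 0<a

    -- The indicator of `Joins e u v` as a polynomial in `basis`. The two orientations exclude each
    -- other, since `e` is not a loop.
    joining : Vertex → Vertex → Edge → Carrier
    joining u v e = basis (src e) u * basis (tgt e) v + basis (tgt e) u * basis (src e) v

  basis-true : ∀ {u v} → u ≡ v → basis u v ≈ 1#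
  basis-true {u} {v} = ⟦⟧-true (u ≟ⱽ v)

  basis-false : ∀ {u v} → u ≢ v → basis u v ≈ 0#
  basis-false {u} {v} = ⟦⟧-false (u ≟ⱽ v)

  joining-true : ∀ {u v e} → Joins e u v → joining u v e ≈ 1#
  joining-true {e = e} (inj₁ (≡.refl , ≡.refl)) = trans
    (+-cong (*-cong (basis-true ≡.refl) (basis-true ≡.refl)) (*-congʳ (basis-false λ eq → loopless e (≡.sym eq))))
    (trans (+-cong (*-identityˡ 1#) (zeroˡ _)) (+-identityʳ 1#))
  joining-true {e = e} (inj₂ (≡.refl , ≡.refl)) = trans
    (+-cong (*-congʳ (basis-false (loopless e))) (*-cong (basis-true ≡.refl) (basis-true ≡.refl)))
    (trans (+-cong (zeroˡ _) (*-identityˡ 1#)) (+-identityˡ 1#))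

  joining-false : ∀ {u v e} → ¬ Joins e u v → joining u v e ≈ 0#
  joining-false {u} {v} {e} ¬joins = trans
    (+-cong (product-zero (src e ≟ⱽ u) (tgt e ≟ⱽ v) λ both → ¬joins (inj₁ both))
            (product-zero (tgt e ≟ⱽ u) (src e ≟ⱽ v) λ (t , s) → ¬joins (inj₂ (s , t))))
    (+-identityʳ 0#)
    where
    product-zero : ∀ {P Q : Set} (P? : Dec P) (Q? : Dec Q) → ¬ (P × Q) → ⟦ P? ⟧ * ⟦ Q? ⟧ ≈ 0#
    product-zero (yes p) Q? ¬pq = trans (*-congˡ (⟦⟧-false Q? λ q → ¬pq (p , q))) (zeroʳ _)
    product-zero (no _)  Q? ¬pq = zeroˡ _

  -- The Laplacian counts neighbours whereas flows count edges; these agree because at most one edge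
  -- joins two vertices.
  adjacency-∑ : ∀ u v → ⟦ adjacent? u v ⟧ ≈ ∑ edges (joining u v)
  adjacency-∑ u v = case adjacent? u v of λ
    { (yes (e , joins)) → trans (⟦⟧-true (adjacent? u v) (e , joins)) (sym (trans
        (∑-point edges edges-unique (edges-complete e) λ e′ e′≢e → joining-false λ joins′ → e′≢e (simple joins′ joins))
        (joining-true joins)))
    ; (no ¬adjacent) → trans (⟦⟧-false (adjacent? u v) ¬adjacent)
        (sym (∑-zero edges λ e → joining-false λ joins → ¬adjacent (e , joins))) }

  ¬adjacent-self : ∀ u → ¬ Adjacent u u
  ¬adjacent-self u (e , inj₁ (≡.refl , eq)) = loopless e (≡.sym eq)
  ¬adjacent-self u (e , inj₂ (≡.refl , eq)) = loopless e (≡.sym eq)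

  laplacian-entry : ∀ u v → L u v ≈ basis u v * ∑ vertices (λ w → ⟦ adjacent? u w ⟧ * r) - ⟦ adjacent? u v ⟧ * r
  laplacian-entry u v with u ≟ⱽ v
  ... | yes ≡.refl = sym (trans
    (+-cong (trans (*-identityˡ _) (sym (multiple-length-filter (adjacent? u) vertices r)))
            (-‿cong (trans (*-congʳ (⟦⟧-false (adjacent? u u) (¬adjacent-self u))) (zeroˡ r))))
    (x-0≈x _))
  ... | no _ = trans (off-diagonal (does (adjacent? u v))) (sym (trans (+-congʳ (zeroˡ _)) (+-identityˡ _)))
    where
    off-diagonal : ∀ b → (if b then - r else 0#) ≈ - ((if b then 1# else 0#) * r)
    off-diagonal true  = -‿cong (sym (*-identityˡ r))
    off-diagonal false = sym (trans (-‿cong (zeroˡ r)) -0#≈0#)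

  laplacian-symmetric : ∀ u v → L u v ≈ L v u
  laplacian-symmetric u v = case u ≟ⱽ v of λ
    { (yes ≡.refl) → refl
    ; (no u≢v) → trans (off-diagonal u≢v) (trans
        (-‿cong (*-congʳ (⟦⟧-cong (adjacent? u v) (adjacent? v u) (mk⇔ adjacent-sym adjacent-sym))))
        (sym (off-diagonal λ v≡u → u≢v (≡.sym v≡u)))) }
    where
    off-diagonal : ∀ {u v} → u ≢ v → L u v ≈ - (⟦ adjacent? u v ⟧ * r)
    off-diagonal {u} {v} u≢v = trans (laplacian-entry u v)
      (trans (+-congʳ (trans (*-congʳ (basis-false u≢v)) (zeroˡ _))) (+-identityˡ _))
    adjacent-sym : ∀ {u v} → Adjacent u v → Adjacent v u
    adjacent-sym (e , joins) = e , Sum.swap joins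

  -- The diagonal entry supplies one `ψ u` per neighbour, which leaves the sum of `ψ u - ψ v` over
  -- the neighbours `v`. Rewritten over edges, each edge contributes its drop, with a sign telling
  -- whether it leaves or enters `u`.
  laplacian-divergence : ∀ ψ u → (L · ψ) u ≈ r * divergence (drop ψ) u
  laplacian-divergence ψ u = begin
    ∑ vertices (λ v → L u v * ψ v)
      ≈⟨ ∑-cong vertices (λ v → trans (*-congʳ (laplacian-entry u v))
           (solve 4 (λ b d a p → (b :* d :- a) :* p := b :* (d :* p) :- a :* p) refl _ _ _ _)) ⟩
    ∑ vertices (λ v → basis u v * (deg * ψ v) - ⟦ adjacent? u v ⟧ * r * ψ v)
      ≈⟨ ∑-distrib-minus vertices _ _ ⟩
    dot (basis u) (λ v → deg * ψ v) - ∑ vertices (λ v → ⟦ adjacent? u v ⟧ * r * ψ v)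
      ≈⟨ +-congʳ (trans (dot-basis u _) (*-distribʳ-∑ vertices (ψ u) _)) ⟩
    ∑ vertices (λ v → ⟦ adjacent? u v ⟧ * r * ψ u) - ∑ vertices (λ v → ⟦ adjacent? u v ⟧ * r * ψ v)
      ≈⟨ ∑-distrib-minus vertices _ _ ⟨
    ∑ vertices (λ v → ⟦ adjacent? u v ⟧ * r * ψ u - ⟦ adjacent? u v ⟧ * r * ψ v)
      ≈⟨ ∑-cong vertices (λ v → trans
           (solve 4 (λ a r p p′ → a :* r :* p :- a :* r :* p′ := r :* (a :* (p :- p′))) refl _ _ _ _)
           (*-congˡ (trans (*-congʳ (adjacency-∑ u v)) (*-distribʳ-∑ edges _ _)))) ⟩
    ∑ vertices (λ v → r * ∑ edges (λ e → joining u v e * (ψ u - ψ v)))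
      ≈⟨ *-distribˡ-∑ vertices r _ ⟨
    r * ∑ vertices (λ v → ∑ edges (λ e → joining u v e * (ψ u - ψ v)))
      ≈⟨ *-congˡ (∑-swap vertices edges _) ⟩
    r * ∑ edges (λ e → ∑ vertices (λ v → joining u v e * (ψ u - ψ v)))
      ≈⟨ *-congˡ (∑-cong edges current) ⟩
    r * ∑ edges (λ e → (basis (src e) u - basis (tgt e) u) * drop ψ e)
      ≈⟨ *-congˡ (divergence-∑ (drop ψ) u) ⟨
    r * divergence (drop ψ) u ∎
    where
    open ≈-Reasoning
    deg : Carrier
    deg = ∑ vertices (λ w → ⟦ adjacent? u w ⟧ * r)

    endpoint : ∀ w w′ → ∑ vertices (λ v → basis w u * basis w′ v * (ψ u - ψ v)) ≈ basis w u * (ψ w - ψ w′)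
    endpoint w w′ = begin
      ∑ vertices (λ v → basis w u * basis w′ v * (ψ u - ψ v))   ≈⟨ ∑-cong vertices (λ v → *-assoc _ _ _) ⟩
      ∑ vertices (λ v → basis w u * (basis w′ v * (ψ u - ψ v))) ≈⟨ *-distribˡ-∑ vertices _ _ ⟨
      basis w u * dot (basis w′) (λ v → ψ u - ψ v)              ≈⟨ *-congˡ (dot-basis w′ _) ⟩
      basis w u * (ψ u - ψ w′)                                  ≈⟨ ⟦⟧-support (w ≟ⱽ u) (λ { ≡.refl → refl }) ⟩
      basis w u * (ψ w - ψ w′)                                  ∎

    current : ∀ e → ∑ vertices (λ v → joining u v e * (ψ u - ψ v)) ≈ (basis (src e) u - basis (tgt e) u) * drop ψ e
    current e = begin
      ∑ vertices (λ v → joining u v e * (ψ u - ψ v))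
        ≈⟨ ∑-cong vertices (λ v → distribʳ _ _ _) ⟩
      ∑ vertices (λ v → basis (src e) u * basis (tgt e) v * (ψ u - ψ v) + basis (tgt e) u * basis (src e) v * (ψ u - ψ v))
        ≈⟨ ∑-distrib-+ vertices _ _ ⟩
      ∑ vertices (λ v → basis (src e) u * basis (tgt e) v * (ψ u - ψ v))
        + ∑ vertices (λ v → basis (tgt e) u * basis (src e) v * (ψ u - ψ v))
        ≈⟨ +-cong (endpoint (src e) (tgt e)) (endpoint (tgt e) (src e)) ⟩
      basis (src e) u * (ψ (src e) - ψ (tgt e)) + basis (tgt e) u * (ψ (tgt e) - ψ (src e))
        ≈⟨ solve 4 (λ x y p p′ → x :* (p :- p′) :+ y :* (p′ :- p) := (x :- y) :* (p :- p′)) refl _ _ _ _ ⟩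
      (basis (src e) u - basis (tgt e) u) * drop ψ e ∎

  dot-laplacian : ∀ ψ χ → dot (L · ψ) χ ≈ r * ∑ edges (λ e → drop ψ e * drop χ e)
  dot-laplacian ψ χ = begin
    ∑ vertices (λ v → (L · ψ) v * χ v)
      ≈⟨ ∑-cong vertices (λ v → trans (*-congʳ (laplacian-divergence ψ v)) (*-assoc _ _ _)) ⟩
    ∑ vertices (λ v → r * (divergence (drop ψ) v * χ v))   ≈⟨ *-distribˡ-∑ vertices r _ ⟨
    r * dot (divergence (drop ψ)) χ                        ≈⟨ *-congˡ (summation-by-parts (drop ψ) χ) ⟨
    r * ∑ edges (λ e → drop ψ e * drop χ e)                ∎
    where open ≈-Reasoning

  dot-laplacian-comm : ∀ ψ χ → dot (L · ψ) χ ≈ dot (L · χ) ψ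
  dot-laplacian-comm ψ χ = trans (dot-laplacian ψ χ)
    (trans (*-congˡ (∑-cong edges λ e → *-comm _ _)) (sym (dot-laplacian χ ψ)))

  dot-cong : ∀ {ψ ψ′ χ} → (∀ v → ψ v ≈ ψ′ v) → dot ψ χ ≈ dot ψ′ χ
  dot-cong ψ≈ψ′ = ∑-cong vertices λ v → *-congʳ (ψ≈ψ′ v)

  r-cancel : ∀ {x} → r * x ≈ 0# → x ≈ 0#
  r-cancel {x} rx≈0 = begin
    x           ≈⟨ *-identityˡ x ⟨
    1# * x      ≈⟨ *-congʳ (recip-inverse a 0<a) ⟨
    a * r * x   ≈⟨ *-assoc a r x ⟩
    a * (r * x) ≈⟨ *-congˡ rx≈0 ⟩
    a * 0#      ≈⟨ zeroʳ a ⟩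
    0#          ∎
    where open ≈-Reasoning

  -- A vector in the kernel has energy 0, and a vanishing sum of squares vanishes term by term.
  harmonic-drop : ∀ ψ → (∀ v → (L · ψ) v ≈ 0#) → ∀ e → ψ (src e) ≈ ψ (tgt e)
  harmonic-drop ψ Lψ≈0 e = trans (x≈y+[x-y] _ _) (trans (+-congˡ
    (square≈0⇒≈0 (∑-nonneg-≈0 edges (λ e → square-nonneg (drop ψ e)) (r-cancel energy≈0) (edges-complete e))))
    (+-identityʳ _))
    where
    energy≈0 : r * ∑ edges (λ e → drop ψ e * drop ψ e) ≈ 0#
    energy≈0 = trans (sym (dot-laplacian ψ ψ)) (∑-zero vertices λ v → trans (*-congʳ (Lψ≈0 v)) (zeroˡ _))

  -- The pseudoinverse of the Laplacian of a connected graph.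

  module PseudoInverse
    (connected : ∀ (ψ : Vector) → (∀ e → ψ (src e) ≈ ψ (tgt e)) → ∀ u v → ψ u ≈ ψ v)
    (L⁺ : Matrix) (isPseudoInverse : IsMoorePenroseInverse L L⁺) where
    open IsMoorePenroseInverse isPseudoInverse

    private
      P : Matrix
      P = L ⊗ L⁺

    ·-assoc : ∀ ψ x → (L · (L⁺ · ψ)) x ≈ (P · ψ) x
    ·-assoc ψ x = begin
      ∑ vertices (λ y → L x y * ∑ vertices (λ z → L⁺ y z * ψ z))
        ≈⟨ ∑-cong vertices (λ y → trans (*-distribˡ-∑ vertices _ _) (∑-cong vertices λ z → sym (*-assoc _ _ _))) ⟩
      ∑ vertices (λ y → ∑ vertices (λ z → L x y * L⁺ y z * ψ z)) ≈⟨ ∑-swap vertices vertices _ ⟩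
      ∑ vertices (λ z → ∑ vertices (λ y → L x y * L⁺ y z * ψ z)) ≈⟨ ∑-cong vertices (λ z → *-distribʳ-∑ vertices (ψ z) _) ⟨
      (P · ψ) x ∎
      where open ≈-Reasoning

    -- Column `y` of the identity minus `L ⊗ L⁺`, the orthogonal projection onto the kernel of `L`.
    residual : Vertex → Vector
    residual y x = basis y x - P x y

    -- Since `L` and `P` are symmetric, `L ⊗ P` is the transpose of `P ⊗ L`, which is `L` by the
    -- first Penrose equation.
    residual-harmonic : ∀ y w → (L · residual y) w ≈ 0#
    residual-harmonic y w = begin
      ∑ vertices (λ x → L w x * (basis y x - P x y))
        ≈⟨ ∑-cong vertices (λ x → solve 3 (λ l b p → l :* (b :- p) := b :* l :- p :* l) refl _ _ _) ⟩
      ∑ vertices (λ x → basis y x * L w x - P x y * L w x)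
        ≈⟨ ∑-distrib-minus vertices _ _ ⟩
      dot (basis y) (L w) - ∑ vertices (λ x → P x y * L w x)
        ≈⟨ +-cong (trans (dot-basis y (L w)) (laplacian-symmetric w y))
                  (-‿cong (trans (∑-cong vertices λ x → *-cong (AA⁺-symm y x) (laplacian-symmetric w x)) (AA⁺A≋A y w))) ⟩
      L y w - L y w ≈⟨ -‿inverseʳ _ ⟩
      0# ∎
      where open ≈-Reasoning

    residual-constant : ∀ y x x′ → residual y x ≈ residual y x′
    residual-constant y = connected (residual y) (harmonic-drop (residual y) (residual-harmonic y))

    residual-symmetric : ∀ x y → residual y x ≈ residual x y
    residual-symmetric x y = +-cong (⟦⟧-cong (y ≟ⱽ x) (x ≟ⱽ y) (mk⇔ ≡.sym ≡.sym)) (-‿cong (AA⁺-symm y x))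

    -- By symmetry all entries of I - L L⁺ are equal, so it annihilates
    -- every vector of total weight 0.
    laplacian-solution : ∀ p p′ x → (L · (L⁺ · (basis p ⊖ basis p′))) x ≈ basis p x - basis p′ x
    laplacian-solution p p′ x = begin
      (L · (L⁺ · (basis p ⊖ basis p′))) x          ≈⟨ ·-assoc (basis p ⊖ basis p′) x ⟩
      ∑ vertices (λ z → P x z * (basis p z - basis p′ z)) ≈⟨ ∑-cong vertices (λ z → *-comm _ _) ⟩
      dot (basis p ⊖ basis p′) (P x)               ≈⟨ dot-basis-⊖ p p′ (P x) ⟩
      P x p - P x p′
        ≈⟨ solve 4 (λ b b′ c c′ → c :- c′ := (b :- b′) :- ((b :- c) :- (b′ :- c′))) refl (basis p x) (basis p′ x) _ _ ⟩
      (basis p x - basis p′ x) - (residual p x - residual p′ x) ≈⟨ +-congˡ (-‿cong (trans (+-congʳ all-equal) (-‿inverseʳ _))) ⟩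
      (basis p x - basis p′ x) - 0#                ≈⟨ x-0≈x _ ⟩
      basis p x - basis p′ x                       ∎
      where
      open ≈-Reasoning
      all-equal : residual p x ≈ residual p′ x
      all-equal = trans (residual-constant p x p′) (trans (residual-symmetric p′ p) (residual-constant p′ p x))

    -- Reciprocity: `φ` and `χ` are the potentials of unit currents from `s` to `t` and from `u` to
    -- `v`. Both sides are `q` times their mutual energy, which is symmetric in the two.
    voltage-drop : ∀ q s t u v → let φ = L⁺ · (basis s ⊖ basis t) in voltage q L⁺ s t u v ≈ q * (φ u - φ v)
    voltage-drop q s t u v = *-congˡ (begin
      dot (basis s ⊖ basis t) χ   ≈⟨ dot-cong (laplacian-solution s t) ⟨
      dot (L · φ) χ               ≈⟨ dot-laplacian-comm φ χ ⟩
      dot (L · χ) φ               ≈⟨ dot-cong (laplacian-solution u v) ⟩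
      dot (basis u ⊖ basis v) φ   ≈⟨ dot-basis-⊖ u v φ ⟩
      φ u - φ v                   ∎)
      where
      open ≈-Reasoning
      φ = L⁺ · (basis s ⊖ basis t)
      χ = L⁺ · (basis u ⊖ basis v)

-- Finite choice and minima up to double negation.

-- The double negation shift over a finite list; it allows shortest walks from all vertices to be
-- chosen simultaneously.
¬¬-All : ∀ {α p} {A : Set α} {P : A → Set p} → (∀ x → ¬ ¬ P x) → ∀ xs → ¬ ¬ All P xs
¬¬-All ¬¬P []       ¬all = ¬all []
¬¬-All ¬¬P (x ∷ xs) ¬all = ¬¬P x λ px → ¬¬-All ¬¬P xs λ pxs → ¬all (px ∷ pxs)

module Minima {κ ℓ₁ ℓ₂ ℓ₃} (K : OrderedField κ ℓ₁ ℓ₂ ℓ₃) where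
  open OrderedField K
  open OrderedFieldProperties K

  -- Neither `P` nor the order is decidable, so both are decided under the double negation. The
  -- candidate `x` supplies a minimiser even when no listed element satisfies `P`.
  ¬¬-minimum : ∀ {α p} {A : Set α} {P : A → Set p} (f : A → Carrier) {x} → P x → ∀ xs →
               ¬ ¬ ∃ λ y → P y × f y ≤ f x × All (λ z → P z → f y ≤ f z) xs
  ¬¬-minimum f px []       ¬min = ¬min (_ , px , ≤-reflexive refl , [])
  ¬¬-minimum {P = P} f {x} px (z ∷ xs) ¬min = ¬¬-excluded-middle λ
    { (no ¬pz) → ¬¬-minimum {P = P} f px xs λ (y , py , y≤x , y≤xs) →
        ¬min (y , py , y≤x , (λ pz → λ _ → ¬pz pz) ∷ y≤xs)
    ; (yes pz) → ¬¬-total (f x) (f z) λ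
      { (inj₁ x≤z) → ¬¬-minimum {P = P} f px xs λ (y , py , y≤x , y≤xs) →
          ¬min (y , py , y≤x , (λ _ → ≤-trans y≤x x≤z) ∷ y≤xs)
      ; (inj₂ z≤x) → ¬¬-minimum {P = P} f pz xs λ (y , py , y≤z , y≤xs) →
          ¬min (y , py , ≤-trans y≤z z≤x , (λ _ → y≤z) ∷ y≤xs) } }

-- Walks, flows and duality in graded digraphs.

module RankedDigraphs (G : Digraph) (rank : Digraph.Vertex G → ℕ)
  (rank-tgt : ∀ e → rank (Digraph.tgt G e) ≡ suc (rank (Digraph.src G e))) where
  open Digraph G

  walk-length : ∀ {u w} es → IsWalk u es w → rank u ℕ.+ length es ≡ rank w
  walk-length []       ≡.refl          = ℕ.+-identityʳ _
  walk-length (e ∷ es) (≡.refl , walk) = ≡.trans (ℕ.+-suc _ _)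
    (≡.trans (≡.cong (ℕ._+ length es) (≡.sym (rank-tgt e))) (walk-length es walk))

  walk-ascending : ∀ {u w} es → IsWalk u es w → All (λ v → rank u ℕ.< rank v) (map tgt es)
  walk-ascending []       _               = []
  walk-ascending (e ∷ es) (≡.refl , walk) =
    src<tgt ∷ All.map (ℕ.<-trans src<tgt) (walk-ascending es walk)
    where
    src<tgt : rank (src e) ℕ.< rank (tgt e)
    src<tgt = ℕ.≤-reflexive (≡.sym (rank-tgt e))

  -- Ranks strictly increase along a walk, so no vertex recurs. Hence the walks of the duality
  -- argument qualify as the paths of the equilibrium condition.
  walk-simple : ∀ {u w} es → IsWalk u es w → Unique (u ∷ map tgt es)
  walk-simple []       _                    = [] ∷ []
  walk-simple (e ∷ es) walk@(≡.refl , rest) =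
    All.map (λ lt → λ { ≡.refl → ℕ.<-irrefl ≡.refl lt }) (walk-ascending (e ∷ es) walk) ∷ walk-simple es rest

  -- All lists of at most the given length. A walk ending in `t` has at most `rank t` edges, so a
  -- shortest one can be sought in a finite list.
  edgeLists : ℕ → List (List Edge)
  edgeLists zero    = [] ∷ []
  edgeLists (suc k) = [] ∷ cartesianProductWith _∷_ edges (edgeLists k)

  ∈-edgeLists : ∀ k es → length es ℕ.≤ k → es ∈ edgeLists k
  ∈-edgeLists zero    []       _         = here ≡.refl
  ∈-edgeLists (suc k) []       _         = here ≡.refl
  ∈-edgeLists (suc k) (e ∷ es) (ℕ.s≤s l) =
    there (∈-cartesianProductWith⁺ _∷_ (edges-complete e) (∈-edgeLists k es l))

  module _ {κ ℓ₁ ℓ₂ ℓ₃} (K : OrderedField κ ℓ₁ ℓ₂ ℓ₃) where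
    open OrderedField K
    open CommutativeRing commutativeRing using (+-rawMonoid)
    open Scalars K
    open OrderedFieldProperties K
    open DifferenceSolver commutativeRing
    open Sums K
    open Minima K
    open Traffic K G
    open Networks K G

    -- Conservation with demand `q` in weak form, tested against every potential: the form shared by
    -- feasible flows and the electrical flow.
    Transports : Vertex → Vertex → Carrier → Flow → Set _
    Transports s t q f = ∀ ψ → ∑ edges (λ e → f e * drop ψ e) ≈ q * (ψ s - ψ t)

    -- Minus the rank is a potential with drop 1 along every edge.
    ∑-transport : ∀ {s t q f g} → Transports s t q f → Transports s t q g → ∑ edges f ≈ ∑ edges g
    ∑-transport {s} {t} {q} f-transports g-transports = trans (total f-transports) (sym (total g-transports))
      where
      height : Vertex → Carrier
      height v = - multiple +-rawMonoid (rank v) 1#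

      drop-height : ∀ e → drop height e ≈ 1#
      drop-height e = trans
        (+-congˡ (-‿cong (-‿cong (reflexive (≡.cong (λ k → multiple +-rawMonoid k 1#) (rank-tgt e))))))
        (solve 2 (λ x y → (:- x) :- (:- (y :+ x)) := y) refl _ _)

      total : ∀ {f} → Transports s t q f → ∑ edges f ≈ q * (height s - height t)
      total transports = trans
        (∑-cong edges λ e → trans (sym (*-identityʳ _)) (*-congˡ (sym (drop-height e))))
        (transports height)

    -- Linear programming duality: the distances to t are feasible dual potentials.
    shortest-walks-bound : ∀ {s t} → (∀ v → ∃ λ es → IsWalk v es t) →
      ∀ w {q f B} → 0# ≤ q → (∀ e → 0# ≤ f e) → Transports s t q f →
      (∀ es → IsWalk s es t → B ≤ q * ∑ es w) → B ≤ ∑ edges (λ e → f e * w e)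
    shortest-walks-bound {s} {t} reachable w {q} {f} {B} 0≤q 0≤f transports B≤ cost<B =
      ¬¬-All ¬¬shortest vertices λ shortest →
        let distance : Vertex → Carrier
            distance v = ∑ (proj₁ (All.lookup shortest (vertices-complete v))) w
            isWalk : ∀ v → IsWalk v (proj₁ (All.lookup shortest (vertices-complete v))) t
            isWalk v = proj₁ (proj₂ (All.lookup shortest (vertices-complete v)))
            minimal : ∀ v es → IsWalk v es t → distance v ≤ ∑ es w
            minimal v = proj₂ (proj₂ (All.lookup shortest (vertices-complete v)))
            drop≤w : ∀ e → drop distance e ≤ w e
            drop≤w e = ≤-trans
              (+-mono-≤ (minimal (src e) (e ∷ _) (≡.refl , isWalk (tgt e))) (≤-reflexive refl))
              (≤-reflexive (solve 2 (λ x y → (x :+ y) :- y := x) refl _ _))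
        in (begin
          B                                           ≤⟨ B≤ _ (isWalk s) ⟩
          q * distance s                              ≈⟨ *-congˡ (solve 2 (λ x y → x := (x :- y) :+ y) refl _ _) ⟩
          -- The empty walk bounds the distance from `t` to itself above by 0, the direction
          -- required here whatever the signs of `w`.
          q * (distance s - distance t + distance t)  ≤⟨ *-monoˡ-≤ 0≤q (+-mono-≤ (≤-reflexive refl) (minimal t [] ≡.refl)) ⟩
          q * (distance s - distance t + 0#)          ≈⟨ *-congˡ (+-identityʳ _) ⟩
          q * (distance s - distance t)               ≈⟨ transports distance ⟨
          ∑ edges (λ e → f e * drop distance e)       ≤⟨ ∑-mono edges (All.universal (λ e → *-monoˡ-≤ (0≤f e) (drop≤w e)) edges) ⟩
          ∑ edges (λ e → f e * w e)                   ∎) cost<B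
      where
      open ≤-Reasoning
      ¬¬shortest : ∀ v → ¬ ¬ ∃ λ es → IsWalk v es t × (∀ es′ → IsWalk v es′ t → ∑ es w ≤ ∑ es′ w)
      ¬¬shortest v ¬shortest = ¬¬-minimum {P = λ es → IsWalk v es t} (λ es → ∑ es w) (proj₂ (reachable v)) (edgeLists (rank t))
        λ (es , walk , _ , minimal) → ¬shortest (es , walk , λ es′ walk′ →
          All.lookup minimal (∈-edgeLists (rank t) es′
            (ℕ.≤-trans (ℕ.m≤n+m _ (rank v)) (ℕ.≤-reflexive (walk-length es′ walk′)))) walk′)

-- The grid as a graded simple graph.

module Grids (m n : ℕ) where
  open Digraph (grid m n)

  rank : Vertex → ℕ
  rank (i , j) = toℕ i ℕ.+ toℕ j

  rank-tgt : ∀ e → rank (tgt e) ≡ suc (rank (src e))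
  rank-tgt (east i j)  = ≡.cong (λ k → suc (k ℕ.+ toℕ j)) (≡.sym (Fin.toℕ-inject₁ i))
  rank-tgt (north i j) = ≡.trans (ℕ.+-suc (toℕ i) (toℕ j)) (≡.cong (λ k → suc (toℕ i ℕ.+ k)) (≡.sym (Fin.toℕ-inject₁ j)))

  open RankedDigraphs (grid m n) rank rank-tgt public

  suc≢inject₁ : ∀ {k} (i : Fin k) → suc i ≢ inject₁ i
  suc≢inject₁ (suc i) eq = suc≢inject₁ i (Fin.suc-injective eq)

  loopless : ∀ e → src e ≢ tgt e
  loopless e eq = ℕ.1+n≢n (≡.trans (≡.sym (rank-tgt e)) (≡.cong rank (≡.sym eq)))

  parallel-equal : ∀ e e′ → src e ≡ src e′ → tgt e ≡ tgt e′ → e ≡ e′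
  parallel-equal (east i j) (east i′ j′) _ eq with Product.,-injective eq
  ... | eqᵢ , ≡.refl with Fin.suc-injective eqᵢ
  ...   | ≡.refl = ≡.refl
  parallel-equal (north i j) (north i′ j′) _ eq with Product.,-injective eq
  ... | ≡.refl , eqⱼ with Fin.suc-injective eqⱼ
  ...   | ≡.refl = ≡.refl
  parallel-equal (east i j) (north i′ j′) eq eq′ =
    contradiction (≡.trans (≡.cong proj₁ eq′) (≡.sym (≡.cong proj₁ eq))) (suc≢inject₁ i)
  parallel-equal (north i j) (east i′ j′) eq eq′ =
    contradiction (≡.trans (≡.cong proj₂ eq′) (≡.sym (≡.cong proj₂ eq))) (suc≢inject₁ j)

  not-antiparallel : ∀ e e′ → src e ≡ tgt e′ → tgt e ≢ src e′
  not-antiparallel e e′ eq eq′ = ℕ.<-asym (src<tgt e)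
    (≡.subst₂ ℕ._<_ (≡.sym (≡.cong rank eq′)) (≡.sym (≡.cong rank eq)) (src<tgt e′))
    where
    src<tgt : ∀ e → rank (src e) ℕ.< rank (tgt e)
    src<tgt e = ℕ.≤-reflexive (≡.sym (rank-tgt e))

  -- Parallel edges are excluded by their coordinates, antiparallel ones by the rank, which would
  -- have to increase both ways.
  joins-unique : ∀ {e e′ u v} → Joins e u v → Joins e′ u v → e ≡ e′
  joins-unique {e} {e′} (inj₁ (≡.refl , ≡.refl)) (inj₁ (s , t)) = parallel-equal e e′ (≡.sym s) (≡.sym t)
  joins-unique {e} {e′} (inj₁ (≡.refl , ≡.refl)) (inj₂ (s , t)) = contradiction (≡.sym s) (not-antiparallel e e′ (≡.sym t))
  joins-unique {e} {e′} (inj₂ (≡.refl , ≡.refl)) (inj₁ (s , t)) = contradiction (≡.sym s) (not-antiparallel e e′ (≡.sym t))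
  joins-unique {e} {e′} (inj₂ (≡.refl , ≡.refl)) (inj₂ (s , t)) = parallel-equal e e′ (≡.sym s) (≡.sym t)

  source≢sink : 1 ℕ.≤ m → gridSource m n ≢ gridSink m n
  source≢sink (ℕ.s≤s _) ()

  sink-reachable : ∀ v → ∃ λ es → IsWalk v es (gridSink m n)
  sink-reachable (i , j) = >-weakInduction (λ i → ∀ j → ∃ λ es → IsWalk (i , j) es (gridSink m n))
    (>-weakInduction (λ j → ∃ λ es → IsWalk (fromℕ m , j) es (gridSink m n))
      ([] , ≡.refl) (λ j (es , walk) → north (fromℕ m) j ∷ es , ≡.refl , walk))
    (λ i reach j → let (es , walk) = reach j in east i j ∷ es , ≡.refl , walk)
    i j

-- The minimum principle on the grid.

module GridPotentials {κ ℓ₁ ℓ₂ ℓ₃} (K : OrderedField κ ℓ₁ ℓ₂ ℓ₃) where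
  open OrderedField K hiding (zero)
  open Scalars K
  open OrderedFieldProperties K
  open DifferenceSolver commutativeRing
  open Sums K
  open Minima K

  grid-connected : ∀ {m n} (ψ : GridVertex m n → Carrier) →
                   (∀ e → ψ (Digraph.src (grid m n) e) ≈ ψ (Digraph.tgt (grid m n) e)) → ∀ u v → ψ u ≈ ψ v
  grid-connected {m} {n} ψ level u v = trans (to-source u) (sym (to-source v))
    where
    to-source : ∀ v → ψ v ≈ ψ (zero , zero)
    to-source (i , j) = <-weakInduction (λ i → ∀ j → ψ (i , j) ≈ ψ (zero , zero))
      (<-weakInduction (λ j → ψ (zero , j) ≈ ψ (zero , zero)) refl
        (λ j eq → trans (sym (level (north zero j))) eq))
      (λ i eq j → trans (sym (level (east i j))) (eq j)) i j

  -- Push-forward along `h`, which for injective `h` is extension by 0. With `inject₁` and `suc` it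
  -- reads off the edge leaving or entering a vertex of a line, and a missing edge at an end counts
  -- as 0, so boundary vertices obey the same formulas.
  fibre : ∀ {k l} → (Fin k → Fin l) → (Fin k → Carrier) → Fin l → Carrier
  fibre h x j = ∑ (allFin _) λ i → ⟦ h i Fin.≟ j ⟧ * x i

  module _ {k l : ℕ} (h : Fin k → Fin l) where

    fibre-image : (∀ {i i′} → h i ≡ h i′ → i ≡ i′) → ∀ x i → fibre h x (h i) ≈ x i
    fibre-image h-injective x i = trans
      (∑-point (allFin k) (Unique.allFin⁺ k) (∈-allFin i)
        λ i′ i′≢i → trans (*-congʳ (⟦⟧-false (h i′ Fin.≟ h i) (λ eq → i′≢i (h-injective eq)))) (zeroˡ _))
      (trans (*-congʳ (⟦⟧-true (h i Fin.≟ h i) ≡.refl)) (*-identityˡ _))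

    fibre-empty : ∀ {j} → (∀ i → h i ≢ j) → ∀ x → fibre h x j ≈ 0#
    fibre-empty h≢j x = ∑-zero (allFin k) λ i → trans (*-congʳ (⟦⟧-false (h i Fin.≟ _) (h≢j i))) (zeroˡ _)

    -- Off the image of `h` the value is 0, hence the assumption `μ ≤ 0#`: this is the Dirichlet
    -- condition at work.
    fibre-≥ : (∀ {i i′} → h i ≡ h i′ → i ≡ i′) → ∀ {x μ} → μ ≤ 0# → (∀ i → μ ≤ x i) → ∀ j → μ ≤ fibre h x j
    fibre-≥ h-injective {x} μ≤0 μ≤x j with Fin.any? (λ i → h i Fin.≟ j)
    ... | yes (i , ≡.refl) = ≤-trans (μ≤x i) (≤-reflexive (sym (fibre-image h-injective x i)))
    ... | no  ¬image       = ≤-trans μ≤0 (≤-reflexive (sym (fibre-empty (λ i eq → ¬image (i , eq)) x)))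

    fibre-mono : ∀ {x y j} → (∀ i → h i ≡ j → x i ≤ y i) → fibre h x j ≤ fibre h y j
    fibre-mono {x} {y} {j} x≤y = ∑-mono (allFin k) (All.universal (λ i → term i (h i Fin.≟ j)) (allFin k))
      where
      term : ∀ i (d : Dec (h i ≡ j)) → ⟦ d ⟧ * x i ≤ ⟦ d ⟧ * y i
      term i (yes eq) = *-monoˡ-≤ 0≤1 (x≤y i eq)
      term i (no _)   = ≤-reflexive (trans (zeroˡ _) (sym (zeroˡ _)))

    fibre-zero : ∀ j → fibre h (λ _ → 0#) j ≈ 0#
    fibre-zero j = ∑-zero (allFin k) λ i → zeroʳ _

    fibre-distrib-minus : ∀ x y j → fibre h (λ i → x i - y i) j ≈ fibre h x j - fibre h y j
    fibre-distrib-minus x y j = trans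
      (∑-cong (allFin k) λ i → solve 3 (λ a b c → a :* (b :- c) := a :* b :- a :* c) refl _ _ _)
      (∑-distrib-minus (allFin k) _ _)

  lineDivergence : ∀ {k} → (Fin k → Carrier) → Fin (suc k) → Carrier
  lineDivergence x i = fibre inject₁ x i - fibre suc x i

  lineDrop : ∀ {k} → (Fin (suc k) → Carrier) → Fin k → Carrier
  lineDrop φ i = φ (inject₁ i) - φ (suc i)

  lineDivergence-distrib-minus : ∀ {k} (x y : Fin k → Carrier) i →
    lineDivergence (λ i → x i - y i) i ≈ lineDivergence x i - lineDivergence y i
  lineDivergence-distrib-minus x y i = trans
    (+-cong (fibre-distrib-minus inject₁ x y i) (-‿cong (fibre-distrib-minus suc x y i)))
    (solve 4 (λ a b c d → (a :- b) :- (c :- d) := (a :- c) :- (b :- d)) refl _ _ _ _)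

  lineDivergence-cong : ∀ {k} {x y : Fin k → Carrier} → (∀ i → x i ≈ y i) → ∀ i → lineDivergence x i ≈ lineDivergence y i
  lineDivergence-cong x≈y i = +-cong (∑-cong (allFin _) λ j → *-congˡ (x≈y j)) (-‿cong (∑-cong (allFin _) λ j → *-congˡ (x≈y j)))

  -- At a minimum the drop on the leaving edge is at most 0 and on the entering edge at least 0. An
  -- edge missing at an end contributes 0, which is the Neumann condition.
  lineDivergence-minimum : ∀ {k} (φ : Fin (suc k) → Carrier) i → (∀ j → φ i ≤ φ j) → lineDivergence (lineDrop φ) i ≤ 0#
  lineDivergence-minimum {k} φ i min = x≤y⇒x-y≤0 (begin
    fibre inject₁ (lineDrop φ) i  ≤⟨ fibre-mono inject₁ {lineDrop φ} {λ _ → 0#} {i} (λ { j ≡.refl → x≤y⇒x-y≤0 (min (suc j)) }) ⟩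
    fibre inject₁ (λ _ → 0#) i    ≈⟨ fibre-zero inject₁ i ⟩
    0#                            ≈⟨ fibre-zero {k} suc i ⟨
    fibre suc (λ _ → 0#) i        ≤⟨ fibre-mono suc {λ _ → 0#} {lineDrop φ} {i} (λ { j ≡.refl → x≤y⇒0≤y-x (min (inject₁ j)) }) ⟩
    fibre suc (lineDrop φ) i      ∎)
    where open ≤-Reasoning

  module _ {m n : ℕ} (φ : Fin (suc m) → Fin (suc n) → Carrier) where

    -- The Laplacian of the grid, up to the factor of the resistance, as a sum of two line
    -- Laplacians. Transposing `φ` exchanges the summands, so the vertical edges reuse the
    -- horizontal argument.
    potentialDivergence : Fin (suc m) → Fin (suc n) → Carrier
    potentialDivergence i j = lineDivergence (lineDrop (flip φ j)) i + lineDivergence (lineDrop (φ i)) j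

    horizontal : Fin m → Fin (suc n) → Carrier
    horizontal i j = lineDrop (flip φ j) i

    -- The horizontal drop is superharmonic, with Neumann conditions in
    -- the vertical and Dirichlet conditions in the horizontal direction.
    -- At a negative minimum its left neighbour would be a minimum too.
    minimum-propagates : ∀ {i j} → potentialDivergence (suc i) j ≤ potentialDivergence (inject₁ i) j →
      horizontal i j ≤ 0# → (∀ i′ j′ → horizontal i j ≤ horizontal i′ j′) →
      fibre suc (flip horizontal j) (inject₁ i) ≤ horizontal i j
    minimum-propagates {i} {j} superharmonic μ≤0 min = begin
      left
        -- Each of the three terms added to `μ` is at most 0: the first by minimality or the
        -- boundary value, the second by minimality along the column, the third by superharmonicity.
        ≈⟨ solve 5 (λ μ l r v v′ → l := μ :+ (μ :- r) :+ (v :- v′) :+ (((r :- μ) :+ v′) :- ((μ :- l) :+ v))) refl μ left right V V′ ⟩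
      μ + (μ - right) + (V - V′) + ((right - μ + V′) - (μ - left + V))
        ≤⟨ +-mono-≤ (+-mono-≤ (+-mono-≤ (≤-reflexive refl) (x≤y⇒x-y≤0 μ≤right)) vertical≤0) (x≤y⇒x-y≤0 superharmonic′) ⟩
      μ + 0# + 0# + 0#
        ≈⟨ trans (+-identityʳ _) (trans (+-identityʳ _) (+-identityʳ _)) ⟩
      μ ∎
      where
      open ≤-Reasoning
      μ     = horizontal i j
      left  = fibre suc (flip horizontal j) (inject₁ i)
      right = fibre inject₁ (flip horizontal j) (suc i)
      V     = lineDivergence (lineDrop (φ (inject₁ i))) j
      V′    = lineDivergence (lineDrop (φ (suc i))) j

      μ≤right : μ ≤ right
      μ≤right = fibre-≥ inject₁ Fin.inject₁-injective μ≤0 (λ i′ → min i′ j) (suc i)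

      superharmonic′ : right - μ + V′ ≤ μ - left + V
      superharmonic′ = begin
        right - μ + V′                                            ≈⟨ +-congʳ (+-congˡ (-‿cong (fibre-image suc Fin.suc-injective _ i))) ⟨
        lineDivergence (flip horizontal j) (suc i) + V′           ≤⟨ superharmonic ⟩
        lineDivergence (flip horizontal j) (inject₁ i) + V        ≈⟨ +-congʳ (+-congʳ (fibre-image inject₁ Fin.inject₁-injective _ i)) ⟩
        μ - left + V                                              ∎

      vertical≤0 : V - V′ ≤ 0#
      vertical≤0 = begin
        V - V′
          ≈⟨ lineDivergence-distrib-minus _ _ j ⟨
        lineDivergence (λ j → lineDrop (φ (inject₁ i)) j - lineDrop (φ (suc i)) j) j
          -- Mixed second differences commute, so the change of the vertical divergence across the
          -- edge is the vertical divergence of the horizontal drop.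
          ≈⟨ lineDivergence-cong (λ j → solve 4 (λ a b c d → (a :- b) :- (c :- d) := (a :- c) :- (b :- d)) refl _ _ _ _) j ⟩
        lineDivergence (lineDrop (horizontal i)) j
          ≤⟨ lineDivergence-minimum (horizontal i) j (min i) ⟩
        0# ∎

  -- A negative minimum is passed on to its left neighbour until it reaches the first edge of the
  -- row, whose left neighbour is the boundary value 0.
  no-negative-minimum : ∀ {m n} (φ : Fin (suc (suc m)) → Fin (suc n) → Carrier) →
    (∀ i j → potentialDivergence φ (suc i) j ≤ potentialDivergence φ (inject₁ i) j) →
    ∀ j i → (∀ i′ j′ → horizontal φ i j ≤ horizontal φ i′ j′) → 0# ≤ horizontal φ i j
  no-negative-minimum {m} φ superharmonic j = <-weakInduction
    (λ i → (∀ i′ j′ → horizontal φ i j ≤ horizontal φ i′ j′) → 0# ≤ horizontal φ i j)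
    (λ min μ<0 → ≤-trans (≤-reflexive (sym (fibre-empty {suc m} suc {zero} (λ _ ()) (flip (horizontal φ) j))))
      (minimum-propagates φ (superharmonic zero j) (<⇒≤ μ<0) min) μ<0)
    (λ i nonneg min μ<0 →
      let left≤μ = ≤-trans (≤-reflexive (sym (fibre-image suc Fin.suc-injective _ (inject₁ i))))
                     (minimum-propagates φ (superharmonic (suc i) j) (<⇒≤ μ<0) min)
      in ≤-trans (nonneg (λ i′ j′ → ≤-trans left≤μ (min i′ j′))) left≤μ μ<0)

  horizontal-nonneg : ∀ {m n} (φ : Fin (suc m) → Fin (suc n) → Carrier) →
    (∀ i j → potentialDivergence φ (suc i) j ≤ potentialDivergence φ (inject₁ i) j) →
    ∀ i j → 0# ≤ horizontal φ i j
  horizontal-nonneg {suc m} {n} φ superharmonic i j μ<0 =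
    ¬¬-minimum {P = λ _ → ⊤} (uncurry (horizontal φ)) {i , j} tt (cartesianProduct (allFin (suc m)) (allFin (suc n)))
      λ ((i₀ , j₀) , _ , min≤μ , minimal) →
        ≤-trans (no-negative-minimum φ superharmonic j₀ i₀ (λ i′ j′ →
                  All.lookup minimal (∈-cartesianProduct⁺ (∈-allFin i′) (∈-allFin j′)) tt))
                min≤μ μ<0

  module _ {m n : ℕ} where
    open Digraph (grid m n)
    open Networks K (grid m n)

    private
      ⟦⟧-pair : ∀ {k l} (i i′ : Fin k) (j j′ : Fin l) →
                ⟦ Product.≡-dec Fin._≟_ Fin._≟_ (i , j) (i′ , j′) ⟧ ≈ ⟦ i Fin.≟ i′ ⟧ * ⟦ j Fin.≟ j′ ⟧
      ⟦⟧-pair i i′ j j′ = trans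
        (⟦⟧-cong (Product.≡-dec Fin._≟_ Fin._≟_ (i , j) (i′ , j′)) ((i Fin.≟ i′) ×-dec (j Fin.≟ j′))
          (mk⇔ Product.,-injective (uncurry (≡.cong₂ _,_))))
        (⟦⟧-× (i Fin.≟ i′) (j Fin.≟ j′))

    ∑-grid-edges : ∀ f → ∑ edges f ≈ ∑ (allFin m) (λ i → ∑ (allFin (suc n)) λ j → f (east i j))
                                   + ∑ (allFin (suc m)) (λ i → ∑ (allFin n) λ j → f (north i j))
    ∑-grid-edges f = trans (∑-++ (map (uncurry east) (cartesianProduct (allFin m) (allFin (suc n)))) _ f) (+-cong
      (trans (∑-map (uncurry east) (cartesianProduct (allFin m) (allFin (suc n))) f) (∑-cartesianProduct (allFin m) (allFin (suc n)) _))
      (trans (∑-map (uncurry north) (cartesianProduct (allFin (suc m)) (allFin n)) f) (∑-cartesianProduct (allFin (suc m)) (allFin n) _)))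

    -- The indicator of a pair factors, so summing over a family of edges becomes a push-forward in
    -- each coordinate; `id` serves for the coordinate that an edge keeps constant.
    fibre-× : ∀ {k l k′ l′} (h : Fin k → Fin l) (h′ : Fin k′ → Fin l′) (x : Fin k → Fin k′ → Carrier) i j →
      ∑ (allFin k) (λ i′ → ∑ (allFin k′) λ j′ → ⟦ Product.≡-dec Fin._≟_ Fin._≟_ (h i′ , h′ j′) (i , j) ⟧ * x i′ j′)
      ≈ fibre h (λ i′ → fibre h′ (x i′) j) i
    fibre-× {k} {k′ = k′} h h′ x i j = ∑-cong (allFin k) λ i′ → trans
      (∑-cong (allFin k′) λ j′ → trans (*-congʳ (⟦⟧-pair (h i′) i (h′ j′) j)) (*-assoc _ _ _))
      (sym (*-distribˡ-∑ (allFin k′) _ _))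

    fibre-cong : ∀ {k l} (h : Fin k → Fin l) {x y} → (∀ i → x i ≈ y i) → ∀ j → fibre h x j ≈ fibre h y j
    fibre-cong h x≈y j = ∑-cong (allFin _) λ i → *-congˡ (x≈y i)

    grid-divergence : ∀ f i j → divergence f (i , j)
      ≈ lineDivergence (λ i → f (east i j)) i + lineDivergence (λ j → f (north i j)) j
    grid-divergence f i j = trans
      (+-cong
        (trans (∑-filter (λ e → src e ≟ⱽ (i , j)) edges f) (trans (∑-grid-edges _) (+-cong
          (trans (fibre-× inject₁ id (λ i j → f (east i j)) i j) (fibre-cong inject₁ (λ i → fibre-image id id _ j) i))
          (trans (fibre-× id inject₁ (λ i j → f (north i j)) i j) (fibre-image id id _ i)))))
        (-‿cong (trans (∑-filter (λ e → tgt e ≟ⱽ (i , j)) edges f) (trans (∑-grid-edges _) (+-cong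
          (trans (fibre-× suc id (λ i j → f (east i j)) i j) (fibre-cong suc (λ i → fibre-image id id _ j) i))
          (trans (fibre-× id suc (λ i j → f (north i j)) i j) (fibre-image id id _ i)))))))
      (solve 4 (λ a b c d → (a :+ b) :- (c :+ d) := (a :- c) :+ (b :- d)) refl _ _ _ _)

    open Electrical K (grid m n) using (basis)

    private
      basis-nonneg : ∀ w v → 0# ≤ basis w v
      basis-nonneg w v with w ≟ⱽ v
      ... | yes _ = 0≤1
      ... | no _  = ≤-reflexive refl

    module _ {a : Carrier} (0≤a : 0# ≤ a) (φ : Vertex → Carrier)
      (div-φ : ∀ v → divergence (drop φ) v ≈ a * (basis (gridSource m n) v - basis (gridSink m n) v)) where

      -- The value 0 separates the two sides, as the divergence is positive at most at the source
      -- and negative at most at the sink. It is applied with `v` the head and `w` the tail of an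
      -- edge.
      divergence-≤ : ∀ v w → gridSource m n ≢ v → gridSink m n ≢ w → divergence (drop φ) v ≤ divergence (drop φ) w
      divergence-≤ v w s≢v t≢w = begin
        divergence (drop φ) v                                 ≈⟨ div-φ v ⟩
        a * (basis (gridSource m n) v - basis (gridSink m n) v) ≤⟨ *-monoˡ-≤ 0≤a (x≤y⇒x-y≤0
                                                                 (≤-trans (≤-reflexive (⟦⟧-false (gridSource m n ≟ⱽ v) s≢v)) (basis-nonneg (gridSink m n) v))) ⟩
        a * 0#                                                ≤⟨ *-monoˡ-≤ 0≤a (x≤y⇒0≤y-x
                                                                 (≤-trans (≤-reflexive (⟦⟧-false (gridSink m n ≟ⱽ w) t≢w)) (basis-nonneg (gridSource m n) w))) ⟩
        a * (basis (gridSource m n) w - basis (gridSink m n) w) ≈⟨ div-φ w ⟨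
        divergence (drop φ) w                                 ∎
        where open ≤-Reasoning

      grid-drop-nonneg : ∀ e → 0# ≤ drop φ e
      grid-drop-nonneg (east i j) = horizontal-nonneg (λ i j → φ (i , j))
        (λ i j → ≤-trans (≤-reflexive (sym (grid-divergence (drop φ) (suc i) j)))
          (≤-trans (divergence-≤ (suc i , j) (inject₁ i , j) (λ ()) (λ eq → Fin.fromℕ≢inject₁ (≡.cong proj₁ eq)))
            (≤-reflexive (grid-divergence (drop φ) (inject₁ i) j)))) i j
      grid-drop-nonneg (north i j) = horizontal-nonneg (λ j i → φ (i , j))
        (λ j i → ≤-trans (≤-reflexive (trans (+-comm _ _) (sym (grid-divergence (drop φ) i (suc j)))))
          (≤-trans (divergence-≤ (i , suc j) (i , inject₁ j) (λ ()) (λ eq → Fin.fromℕ≢inject₁ (≡.cong proj₂ eq)))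
            (≤-reflexive (trans (grid-divergence (drop φ) i (inject₁ j)) (+-comm _ _))))) j i

-- Walks and flows after adding an edge.

module Augmented {κ ℓ₁ ℓ₂ ℓ₃} (K : OrderedField κ ℓ₁ ℓ₂ ℓ₃) (G : Digraph) (u v : Digraph.Vertex G) where
  open OrderedField K
  open Scalars K
  open Sums K
  open Digraph G

  private
    module G⁺ = Digraph (addEdge G u v)
    module N = Networks K G
    module N⁺ = Networks K (addEdge G u v)

  old-walk : ∀ {x y} es → IsWalk x es y → G⁺.IsWalk x (map just es) y
  old-walk []       eq          = eq
  old-walk (e ∷ es) (eq , walk) = eq , old-walk es walk

  old-path : ∀ {x y} es → IsWalk x es y → Unique (x ∷ map tgt es) → G⁺.Path x y
  old-path {x} es walk unique = record
    { trail  = map just es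
    ; isWalk = old-walk es walk
    ; simple = ≡.subst (λ vs → Unique (x ∷ vs)) (List.map-∘ es) unique
    }

  -- The chord adds no vertex, so `ψ` is a potential on the augmented graph as well; removing the
  -- chord's share from the total drop there leaves the share of the old edges.
  restricted-drop : ∀ {s t q} g → Traffic.IsFeasible K (addEdge G u v) s t q g → s ≢ t → ∀ ψ →
    ∑ edges (λ e → g (just e) * N.drop ψ e) ≈ q * (ψ s - ψ t) - g nothing * (ψ u - ψ v)
  restricted-drop {s} {t} {q} g feasible s≢t ψ = begin
    old                                               ≈⟨ solve 2 (λ x y → y := (x :+ y) :- x) refl new old ⟩
    (new + old) - new                                 ≈⟨ +-congʳ (+-congˡ (∑-map just edges _)) ⟨
    ∑ G⁺.edges (λ e → g e * N⁺.drop ψ e) - new        ≈⟨ +-congʳ (N⁺.flow-drop (N⁺.feasible-divergence s≢t feasible) ψ) ⟩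
    q * (ψ s - ψ t) - new                             ∎
    where
    open OrderedFieldProperties K
    open ≈-Reasoning
    open DifferenceSolver commutativeRing
    old = ∑ edges (λ e → g (just e) * N.drop ψ e)
    new = g nothing * (ψ u - ψ v)

-- Comparing both equilibria with the electrical flow.

module GridTraffic {κ ℓ₁ ℓ₂ ℓ₃} (K : OrderedField κ ℓ₁ ℓ₂ ℓ₃) (m n : ℕ) (u v : GridVertex m n) where
  open OrderedField K hiding (zero)
  open Scalars K
  open OrderedFieldProperties K
  open DifferenceSolver commutativeRing
  open Sums K
  open Digraph (grid m n)
  open Electrical K (grid m n)
  open Grids m n
  open GridPotentials K
  open Networks K (grid m n)
  open Augmented K (grid m n) u v using (old-path; restricted-drop)

  private
    module Old = Traffic K (grid m n)
    module New = Traffic K (addEdge (grid m n) u v)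

  module _ (1≤m : 1 ≤ᴺ m) (q a b c d : Carrier) (0<q : 0# < q) (0<a : 0# < a)
    (L⁺ : Matrix) (isPseudoInverse : IsMoorePenroseInverse (laplacian a 0<a) L⁺) where
    open Laplacians K (grid m n) loopless (λ {e} {e′} → joins-unique {e} {e′}) a 0<a
    open PseudoInverse (grid-connected {m} {n}) L⁺ isPseudoInverse

    private
      s t : Vertex
      s = gridSource m n
      t = gridSink m n

      s≢t : s ≢ t
      s≢t = source≢sink 1≤m

      r : Carrier
      r = recip a 0<a

      φ : Vector
      φ = L⁺ · (basis s ⊖ basis t)

      ℓ-old : Old.Latency
      ℓ-old = λ _ → affine a b

      ℓ-new : New.Latency
      ℓ-new = maybe ℓ-old (affine c d)

    electrical : Old.Flow
    electrical e = q * r * drop φ e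

    ar≈1 : a * r ≈ 1#
    ar≈1 = recip-inverse a 0<a

    φ-divergence : ∀ w → divergence (drop φ) w ≈ a * (basis s w - basis t w)
    φ-divergence w = begin
      divergence (drop φ) w           ≈⟨ *-identityˡ _ ⟨
      1# * divergence (drop φ) w      ≈⟨ *-congʳ ar≈1 ⟨
      a * r * divergence (drop φ) w   ≈⟨ *-assoc _ _ _ ⟩
      a * (r * divergence (drop φ) w) ≈⟨ *-congˡ (laplacian-divergence φ w) ⟨
      a * (laplacian a 0<a · φ) w     ≈⟨ *-congˡ (laplacian-solution s t w) ⟩
      a * (basis s w - basis t w)     ∎
      where open ≈-Reasoning

    electrical-nonneg : ∀ e → 0# ≤ electrical e
    electrical-nonneg e = *-nonneg (*-nonneg (<⇒≤ 0<q) (recip-nonneg a 0<a)) (grid-drop-nonneg (<⇒≤ 0<a) φ φ-divergence e)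

    electrical-transports : Transports K s t q electrical
    electrical-transports ψ = begin
      ∑ edges (λ e → q * r * drop φ e * drop ψ e)    ≈⟨ ∑-cong edges (λ e → *-assoc _ _ _) ⟩
      ∑ edges (λ e → q * r * (drop φ e * drop ψ e))  ≈⟨ *-distribˡ-∑ edges (q * r) _ ⟨
      q * r * ∑ edges (λ e → drop φ e * drop ψ e)    ≈⟨ *-assoc _ _ _ ⟩
      q * (r * ∑ edges (λ e → drop φ e * drop ψ e))  ≈⟨ *-congˡ (dot-laplacian φ ψ) ⟨
      q * dot (laplacian a 0<a · φ) ψ                ≈⟨ *-congˡ (dot-cong (laplacian-solution s t)) ⟩
      q * dot (basis s ⊖ basis t) ψ                  ≈⟨ *-congˡ (dot-basis-⊖ s t ψ) ⟩
      q * (ψ s - ψ t)                                ∎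
      where open ≈-Reasoning

    -- Ohm's law makes a times the electrical flow a gradient.
    pairing : ∀ (f : Old.Flow) → a * ∑ edges (λ e → f e * electrical e) ≈ q * ∑ edges (λ e → f e * drop φ e)
    pairing f = begin
      a * ∑ edges (λ e → f e * electrical e)              ≈⟨ *-distribˡ-∑ edges a _ ⟩
      ∑ edges (λ e → a * (f e * (q * r * drop φ e)))      ≈⟨ ∑-cong edges (λ e → solve 5 (λ a f q r k → a :* (f :* (q :* r :* k)) := (a :* r) :* (q :* (f :* k))) refl _ _ _ _ _) ⟩
      ∑ edges (λ e → a * r * (q * (f e * drop φ e)))      ≈⟨ ∑-cong edges (λ e → trans (*-congʳ ar≈1) (*-identityˡ _)) ⟩
      ∑ edges (λ e → q * (f e * drop φ e))                ≈⟨ *-distribˡ-∑ edges q _ ⟨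
      q * ∑ edges (λ e → f e * drop φ e)                  ∎
      where open ≈-Reasoning

    -- The value is the same for all `f` with demand `q`, the electrical flow included, so the
    -- difference of `f` and the electrical flow is orthogonal to the latter.
    pairing-transport : ∀ {f} → Transports K s t q f → a * ∑ edges (λ e → f e * electrical e) ≈ q * (q * (φ s - φ t))
    pairing-transport {f} transports = trans (pairing f) (*-congˡ (transports φ))

    -- Thomson's principle.
    energy-≤ : ∀ {f} → Transports K s t q f → q * (q * (φ s - φ t)) ≤ a * ∑ edges (λ e → f e * f e)
    energy-≤ {f} transports = 0≤y-x⇒x≤y (begin
      0#
        ≤⟨ *-nonneg (<⇒≤ 0<a) (∑-nonneg edges (λ e → square-nonneg (f e - electrical e))) ⟩
      a * ∑ edges (λ e → (f e - electrical e) * (f e - electrical e))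
        ≈⟨ *-congˡ (trans (∑-cong edges λ e →
             solve 2 (λ x y → (x :- y) :* (x :- y) := (x :* x :- x :* y) :+ (y :* y :- x :* y)) refl _ _)
             (trans (∑-distrib-+ edges _ _) (+-cong (∑-distrib-minus edges _ _) (∑-distrib-minus edges _ _)))) ⟩
      a * ((∑ edges (λ e → f e * f e) - fE) + (EE - fE))
        ≈⟨ solve 4 (λ a x y z → a :* ((x :- y) :+ (z :- y)) := (a :* x :- a :* y) :+ (a :* z :- a :* y)) refl _ _ _ _ ⟩
      (a * ∑ edges (λ e → f e * f e) - a * fE) + (a * EE - a * fE)
        ≈⟨ +-cong (+-congˡ (-‿cong fE≈)) (+-cong (pairing-transport electrical-transports) (-‿cong fE≈)) ⟩
      (a * ∑ edges (λ e → f e * f e) - D) + (D - D)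
        ≈⟨ trans (+-congˡ (-‿inverseʳ D)) (+-identityʳ _) ⟩
      a * ∑ edges (λ e → f e * f e) - D ∎)
      where
      open ≤-Reasoning
      fE = ∑ edges (λ e → f e * electrical e)
      EE = ∑ edges (λ e → electrical e * electrical e)
      D  = q * (q * (φ s - φ t))
      fE≈ = pairing-transport transports

    module _ (f : Old.Flow) (f-equilibrium : Old.IsUserEquilibrium ℓ-old s t q f)
             (g : New.Flow) (g-equilibrium : New.IsUserEquilibrium ℓ-new s t q g) where

      private
        V : Carrier
        V = voltage q L⁺ s t u v

        D : Carrier
        D = q * (q * (φ s - φ t))

        total : Carrier
        total = ∑ edges electrical

      f-transports : Transports K s t q f
      f-transports = flow-drop (feasible-divergence s≢t (Old.IsUserEquilibrium.feasible f-equilibrium))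

      old-cost-≥ : D + b * total ≤ Old.totalCost ℓ-old f
      old-cost-≥ = begin
        D + b * total
          -- Every unit of flow crosses `m + n` edges, so the constant part `b` of the latency costs
          -- `f` and the electrical flow the same.
          ≤⟨ +-mono-≤ (energy-≤ f-transports) (≤-reflexive (*-congˡ (∑-transport K electrical-transports f-transports))) ⟩
        a * ∑ edges (λ e → f e * f e) + b * ∑ edges f
          ≈⟨ +-cong (*-distribˡ-∑ edges a _) (*-distribˡ-∑ edges b f) ⟩
        ∑ edges (λ e → a * (f e * f e)) + ∑ edges (λ e → b * f e)
          ≈⟨ ∑-distrib-+ edges _ _ ⟨
        ∑ edges (λ e → a * (f e * f e) + b * f e)
          ≈⟨ ∑-cong edges (λ e → solve 3 (λ a b x → a :* (x :* x) :+ b :* x := x :* (a :* x :+ b)) refl _ _ _) ⟩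
        ∑ edges (λ e → f e * (a * f e + b)) ∎
        where open ≤-Reasoning

      new-cost-≤ : New.totalCost ℓ-new g ≤ D - V * g nothing + b * total
      new-cost-≤ = begin
        New.totalCost ℓ-new g
          -- Duality with the new latencies of the grid edges as weights. Grid walks are still paths
          -- of the augmented network, so `q` times the latency of each of them bounds the new cost.
          ≤⟨ shortest-walks-bound K sink-reachable (λ e → affine a b (g (just e)))
               (<⇒≤ 0<q) electrical-nonneg electrical-transports walk-bound ⟩
        ∑ edges (λ e → electrical e * (a * g (just e) + b))
          ≈⟨ ∑-cong edges (λ e → solve 4 (λ a b x y → y :* (a :* x :+ b) := a :* (x :* y) :+ b :* y) refl _ _ _ _) ⟩
        ∑ edges (λ e → a * (g (just e) * electrical e) + b * electrical e)
          ≈⟨ ∑-distrib-+ edges _ _ ⟩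
        ∑ edges (λ e → a * (g (just e) * electrical e)) + ∑ edges (λ e → b * electrical e)
          ≈⟨ +-cong (*-distribˡ-∑ edges a _) (*-distribˡ-∑ edges b _) ⟨
        a * ∑ edges (λ e → g (just e) * electrical e) + b * total
          ≈⟨ +-congʳ (trans (pairing (λ e → g (just e)))
               (*-congˡ (restricted-drop g (New.IsUserEquilibrium.feasible g-equilibrium) s≢t φ))) ⟩
        q * (q * (φ s - φ t) - g nothing * (φ u - φ v)) + b * total
          ≈⟨ +-congʳ (solve 4 (λ q x z w → q :* (x :- z :* w) := q :* x :- (q :* w) :* z) refl _ _ _ _) ⟩
        D - q * (φ u - φ v) * g nothing + b * total
          ≈⟨ +-congʳ (+-congˡ (-‿cong (*-congʳ (voltage-drop q s t u v)))) ⟨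
        D - V * g nothing + b * total ∎
        where
        open ≤-Reasoning
        walk-bound : ∀ es → IsWalk s es t → New.totalCost ℓ-new g ≤ q * ∑ es (λ e → affine a b (g (just e)))
        walk-bound es walk = ≤-trans
          (Networks.equilibrium-cost-≤ K (addEdge (grid m n) u v) s≢t g-equilibrium (old-path es walk (walk-simple es walk)))
          (≤-reflexive (*-congˡ (∑-map just es _)))

      -- The energy `D` and the constant part `b * total` of the electrical flow's cost occur in
      -- both bounds and cancel.
      cost-difference-≤ : New.totalCost ℓ-new g - Old.totalCost ℓ-old f ≤ - (V * g nothing)
      cost-difference-≤ = 0≤y-x⇒x≤y (begin
        0#
          ≤⟨ +-nonneg (x≤y⇒0≤y-x old-cost-≥) (x≤y⇒0≤y-x new-cost-≤) ⟩
        (Old.totalCost ℓ-old f - (D + b * total)) + (D - V * g nothing + b * total - New.totalCost ℓ-new g)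
          ≈⟨ solve 5 (λ o n d y z → (o :- (d :+ y)) :+ (d :- z :+ y :- n) := (:- z) :- (n :- o)) refl _ _ _ _ _ ⟩
        - (V * g nothing) - (New.totalCost ℓ-new g - Old.totalCost ℓ-old f) ∎)
        where open ≤-Reasoning

      -- The paradox makes `- (V * g nothing)` positive, and as the chord flow is nonnegative the
      -- sign must come from `V`.
      paradox⇒V<0 : Old.totalCost ℓ-old f < New.totalCost ℓ-new g → V < 0#
      paradox⇒V<0 old<new = 0<-xy⇒x<0
        (New.IsFeasible.nonneg (New.IsUserEquilibrium.feasible g-equilibrium) nothing)
        (<-≤-trans (x<y⇒0<y-x old<new) cost-difference-≤)

theorem2p14 :
  ∀ {κ ℓ₁ ℓ₂ ℓ₃} (K : OrderedField κ ℓ₁ ℓ₂ ℓ₃) →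
  let open OrderedField K
      open Scalars K
  in
  (m n : ℕ) → 1 ≤ᴺ m → 1 ≤ᴺ n →
  (q a b c d : Carrier) →
  0# < q → (0<a : 0# < a) → 0# ≤ b → 0# ≤ c → 0# ≤ d →
  let G = grid m n
      s = gridSource m n
      t = gridSink m n
      open Electrical K G
  in
  (u v : GridVertex m n) → Digraph.IsChord G u v →
  (L⁺ : Matrix) → IsMoorePenroseInverse (laplacian a 0<a) L⁺ →
  let G⁺ = addEdge G u v
      module Old = Traffic K G
      module New = Traffic K G⁺
      ℓ-old : Old.Latency
      ℓ-old = λ _ → affine a b
      ℓ-new : New.Latency
      ℓ-new = maybe ℓ-old (affine c d)
  in
  (f : Old.Flow) → Old.IsUserEquilibrium ℓ-old s t q f →
  (g : New.Flow) → New.IsUserEquilibrium ℓ-new s t q g →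
  let z*    = g nothing
      C-old = Old.totalCost ℓ-old f
      C-new = New.totalCost ℓ-new g
      V-uv  = voltage q L⁺ s t u v
  in
  (0# < z* → z* ≤ q → C-new - C-old ≤ - (V-uv * z*))
  × (C-old < C-new → V-uv < 0#)
theorem2p14 K m n 1≤m _ q a b c d 0<q 0<a _ _ _ u v _ L⁺ isPseudoInverse f f-equilibrium g g-equilibrium =
  (λ _ _ → cost-difference-≤ 1≤m q a b c d 0<q 0<a L⁺ isPseudoInverse f f-equilibrium g g-equilibrium) ,
  paradox⇒V<0 1≤m q a b c d 0<q 0<a L⁺ isPseudoInverse f f-equilibrium g g-equilibrium
  where open GridTraffic K m n u v
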